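{- Let $(G,\sigma)$ be a connected signed simple graph of maximum degree $3$ which is not (switching) isomorphic to $(K_4,-)$. Then $\chi_c(G,\sigma)\le \frac{10}{3}$.
   Context: A signed graph $(G,\sigma)$ is a graph $G$ with a sign assignment $\sigma:E(G)\to\{+,-\}$; $(K_4,-)$ denotes $K_4$ with all edges negative. Switching a vertex reverses the signs of all edges incident to it; two signed graphs are switching equivalent if one is obtained from the other by switching a set of vertices, and "(switching) isomorphic" means isomorphic after a switching. For integers $p\ge 2q>0$ with $p$ even, the signed circular clique $K^s_{p;q}$ has vertex set $\{0,1,\dots,p-1\}$, where $ij$ (with $i\ne j$ or $i=j$) is a negative edge iff $q\le |i-j|\le p-q$, and a positive edge iff $|i-j|\le \frac p2-q$ or $|i-j|\ge \frac p2+q$ (so every vertex has a positive loop). An edge-sign preserving homomorphism of $(G,\sigma)$ to $(H,\pi)$ is a map $f:V(G)\to V(H)$ such that each edge $uv$ is mapped to an edge $f(u)f(v)$ with $\pi(f(u)f(v))=\sigma(uv)$. A signed graph with no negative loop admits a circular $\frac pq$-coloring if it has an edge-sign preserving homomorphism to $K^s_{p;q}$, and its circular chromatic number is $\chi_c(G,\sigma)=\inf\{\frac pq : (G,\sigma)\text{ has an edge-sign preserving homomorphism to } K^s_{p;q}\}$. -}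

module Defs where

open import Data.Nat using (ℕ; zero; suc; _+_; _*_; _∸_; _≤_; _<_; ∣_-_∣)
open import Data.Bool using (Bool; true; false; if_then_else_; _xor_)
open import Data.Fin using (Fin; toℕ)
open import Data.List using (List; []; _∷_; map; allFin)
open import Data.Nat.ListAction using (sum)
open import Data.Product using (Σ; ∃; ∃-syntax; _×_; _,_)
open import Data.Sum using (_⊎_)
open import Function.Bundles using (Bijection)
open import Relation.Binary.PropositionalEquality using (_≡_; setoid)

data Sign : Set where
  pos neg : Sign

flipSign : Sign → Sign
flipSign pos = neg
flipSign neg = pos

-- A finite simple signed graph on vertex set Fin n.  'adj' is the
-- (symmetric, loopless) adjacency relation; 'sign u v' is the sign of the
-- edge uv (only meaningful when adj u v ≡ true).
record SignedGraph : Set where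
  field
    n         : ℕ
    adj       : Fin n → Fin n → Bool
    sign      : Fin n → Fin n → Sign
    adj-sym   : ∀ u v → adj u v ≡ adj v u
    adj-irr   : ∀ v → adj v v ≡ false
    sign-sym  : ∀ u v → sign u v ≡ sign v u

open SignedGraph public

degree : (G : SignedGraph) → Fin (n G) → ℕ
degree G v = sum (map (λ u → if adj G v u then 1 else 0) (allFin (n G)))

MaxDegree : SignedGraph → ℕ → Set
MaxDegree G d = (∀ v → degree G v ≤ d) × (∃[ v ] degree G v ≡ d)

data Walk (G : SignedGraph) : Fin (n G) → Fin (n G) → Set where
  here : ∀ {v} → Walk G v v
  step : ∀ {u w v} → adj G u w ≡ true → Walk G w v → Walk G u v

Connected : SignedGraph → Set
Connected G = ∀ u v → Walk G u v

switch : (G : SignedGraph) → (Fin (n G) → Bool) → SignedGraph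
switch G S = record
  { n = n G
  ; adj = adj G
  ; sign = λ u v → if S u xor S v then flipSign (sign G u v) else sign G u v
  ; adj-sym = adj-sym G
  ; adj-irr = adj-irr G
  ; sign-sym = λ u v → sym-helper u v
  }
  where
    open import Relation.Binary.PropositionalEquality using (cong₂; cong)
    open import Data.Bool.Properties using (xor-comm)
    sym-helper : ∀ u v → (if S u xor S v then flipSign (sign G u v) else sign G u v)
                        ≡ (if S v xor S u then flipSign (sign G v u) else sign G v u)
    sym-helper u v rewrite xor-comm (S u) (S v) | sign-sym G u v = Relation.Binary.PropositionalEquality.refl

record Iso (G H : SignedGraph) : Set where
  field
    f        : Bijection (setoid (Fin (n G))) (setoid (Fin (n H)))
  open Bijection f renaming (to to φ)
  field
    adj-pres  : ∀ u v → adj G u v ≡ adj H (φ u) (φ v)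
    sign-pres : ∀ u v → adj G u v ≡ true → sign G u v ≡ sign H (φ u) (φ v)

SwitchIso : SignedGraph → SignedGraph → Set
SwitchIso G H = Σ (Fin (n G) → Bool) λ S → Iso (switch G S) H

open import Data.Fin.Properties using (_≟_)
open import Relation.Nullary using (does)
open import Data.Bool using (not)

K4neg : SignedGraph
K4neg = record
  { n = 4
  ; adj = λ u v → not (does (u ≟ v))
  ; sign = λ _ _ → neg
  ; adj-sym = adjsym
  ; adj-irr = adjirr
  ; sign-sym = λ _ _ → Relation.Binary.PropositionalEquality.refl
  }
  where
    open Relation.Binary.PropositionalEquality using (refl)
    adjsym : ∀ (u v : Fin 4) → not (does (u ≟ v)) ≡ not (does (v ≟ u))
    adjsym u v with u ≟ v | v ≟ u
    ... | Relation.Nullary.yes _ | Relation.Nullary.yes _ = refl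
    ... | Relation.Nullary.no _  | Relation.Nullary.no _  = refl
    ... | Relation.Nullary.yes p | Relation.Nullary.no q = Data.Empty.⊥-elim (q (Relation.Binary.PropositionalEquality.sym p))
      where import Data.Empty
    ... | Relation.Nullary.no q | Relation.Nullary.yes p = Data.Empty.⊥-elim (q (Relation.Binary.PropositionalEquality.sym p))
      where import Data.Empty
    adjirr : ∀ (v : Fin 4) → not (does (v ≟ v)) ≡ false
    adjirr v with v ≟ v
    ... | Relation.Nullary.yes _ = refl
    ... | Relation.Nullary.no q = Data.Empty.⊥-elim (q refl)
      where import Data.Empty

-- Signed circular clique K^s_{p;q} with p = 2k (p even), vertex set Fin (2k).
-- For vertices i j with d = |i - j|:
--   negative edge  iff  q ≤ d ≤ p - q
--   positive edge  iff  d ≤ p/2 - q  or  d ≥ p/2 + q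
NegEdgeK : (k q : ℕ) → Fin (2 * k) → Fin (2 * k) → Set
NegEdgeK k q i j = (q ≤ ∣ toℕ i - toℕ j ∣) × (∣ toℕ i - toℕ j ∣ ≤ 2 * k ∸ q)

PosEdgeK : (k q : ℕ) → Fin (2 * k) → Fin (2 * k) → Set
PosEdgeK k q i j = (∣ toℕ i - toℕ j ∣ ≤ k ∸ q) ⊎ (k + q ≤ ∣ toℕ i - toℕ j ∣)

CircHom : SignedGraph → (k q : ℕ) → Set
CircHom G k q =
  Σ (Fin (n G) → Fin (2 * k)) λ φ →
    ∀ u v → adj G u v ≡ true →
      (sign G u v ≡ pos → PosEdgeK k q (φ u) (φ v)) ×
      (sign G u v ≡ neg → NegEdgeK k q (φ u) (φ v))

-- (G,σ) admits a circular p/q-coloring, p = 2k even, p ≥ 2q > 0.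
CircColorable : SignedGraph → (k q : ℕ) → Set
CircColorable G k q = (0 < q) × (q ≤ k) × CircHom G k q

-- χ_c(G,σ) ≤ a/b, i.e. inf { p/q : (G,σ) is circular p/q-colorable } ≤ a/b:
-- for every rational c/d > a/b there is an admissible p/q ≤ c/d.
ChiCLe : SignedGraph → (a b : ℕ) → Set
ChiCLe G a b = ∀ (c d : ℕ) → 0 < d → a * d < c * b →
  ∃[ k ] ∃[ q ] (CircColorable G k q × ((2 * k) * d ≤ c * q))

{-# OPTIONS --safe #-}
module Submission where

-- K^s_{10;3} is complete: colours in Z/10 at circular distance at most 2 are joined positively, the others
-- negatively, and adding 5 to a colour switches.  So a coloured neighbour confines a vertex to 5 consecutive
-- colours, and it suffices to colour, by induction on the number of non-isolated vertices, every subcubic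
-- signed graph without an antibalanced K₄.
--
-- Reducible configurations, each assumed absent from then on: a 4-cycle with a chord and a negative 4-cycle
-- are deleted and coloured from these lists; in a K₂₃ the two vertices of degree 3 are now twins up to
-- switching; a triangle abc is deleted, and the outer neighbours of a and b are joined so that the lists of
-- a, b and c cannot all agree up to switching, which is the only obstruction.
--
-- Otherwise delete a vertex v with its neighbours and join the two outer neighbours of each neighbour d of v
-- by the sign of the path through d.  Then d keeps 3 consecutive colours, which exclude only 3 colours at v,
-- and 3 · 3 < 10.  Since all 4-cycles are positive, a triangle with exactly one new edge is positive; as at
-- most three edges are new, and not all at one vertex for want of a K₂₃, no antibalanced K₄ arises.

open import Defs
open import Data.Bool using (Bool; true; false; T; not; _∧_; _∨_; _xor_; if_then_else_)
open import Data.Bool.Properties using (T?; not-involutive; ∧-comm; ∨-comm) renaming (_≟_ to _≟ᵇ_)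
open import Data.Empty using (⊥; ⊥-elim)
open import Data.Fin using (Fin; toℕ)
open import Data.Fin.Patterns
open import Data.Fin.Properties using (_≟_; any?)
open import Data.List using (List; []; _∷_; map; length; filter; allFin)
open import Data.List.Membership.Propositional using (_∈_; _∉_; lose)
open import Data.List.Membership.Propositional.Properties using (∈-allFin; ∈-filter⁺)
import Data.List.Membership.DecPropositional as DecMembership
open import Data.List.Properties using (filter-notAll)
open import Data.List.Relation.Unary.All as All using (All; []; _∷_; lookup)
open import Data.List.Relation.Unary.AllPairs using (AllPairs; []; _∷_)
open import Data.List.Relation.Unary.Any as Any using (here; there)
open import Data.Maybe using (Maybe; just; nothing; zipWith; _<∣>_)
open import Data.Maybe.Properties using (just-injective; ≡-dec)
open import Data.Nat using (ℕ; zero; suc; _+_; _∸_; _≤_; z≤n; s≤s; s≤s⁻¹; _≤?_; _≤ᵇ_; ∣_-_∣)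
open import Data.Nat.DivMod using (_mod_)
open import Data.Nat.ListAction using (sum)
open import Data.Nat.Properties using (≤-refl; ≤-trans; <⇒≤; ∣-∣-comm)
open import Data.Product using (∃; ∃-syntax; _×_; _,_; proj₁; proj₂)
open import Data.Sum using (_⊎_; inj₁; inj₂; [_,_]′)
open import Function using (_∘_)
open import Relation.Binary.PropositionalEquality
open import Relation.Nullary using (Dec; yes; no; does; ¬_)
open import Relation.Nullary.Decidable using (map′; _×-dec_; _⊎-dec_; _→-dec_; ¬?)
open import Relation.Unary using (Decidable)

-- Colours

infixr 7 _·_
_·_ : Sign → Sign → Sign
pos · t = t
neg · t = flipSign t

_≟ˢ_ : (s t : Sign) → Dec (s ≡ t)
pos ≟ˢ pos = yes refl
pos ≟ˢ neg = no λ ()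
neg ≟ˢ pos = no λ ()
neg ≟ˢ neg = yes refl

Colour : Set
Colour = Fin 10

-- Circular distance at most `r` on Z/10: the second disjunct measures around the other side.
within : ℕ → Colour → Colour → Bool
within r i j = (∣ toℕ i - toℕ j ∣ ≤ᵇ r) ∨ (10 ∸ r ≤ᵇ ∣ toℕ i - toℕ j ∣)

near : Colour → Colour → Bool
near = within 2

-- Two colours are always joined in K^s_{10;3}, by exactly one sign.
ok : Sign → Colour → Colour → Bool
ok pos i j = near i j
ok neg i j = not (near i j)

-- A record and not the bare equation, so that unification can read the sign and both colours off
-- the type.
record Ok (s : Sign) (i j : Colour) : Set where
  constructor mkOk
  field isOk : ok s i j ≡ true

Ok? : ∀ s i j → Dec (Ok s i j)
Ok? s i j = map′ mkOk Ok.isOk (ok s i j ≟ᵇ true)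

Near : Colour → Colour → Set
Near = Ok pos

rotate : Colour → Colour → Colour
rotate k i = (toℕ k + toℕ i) mod 10

opp : Colour → Colour
opp = rotate 5F

act : Sign → Colour → Colour
act pos i = i
act neg i = opp i

-- Finite facts about signs and colours are proved by running their decision procedures.
decide : {A : Set} (A? : Dec A) → does A? ≡ true → A
decide (yes a) _ = a

-- Spelled out, yet definitionally `allFin 10`, which is why `∈-allFin` applies to it.
palette : List Colour
palette = 0F ∷ 1F ∷ 2F ∷ 3F ∷ 4F ∷ 5F ∷ 6F ∷ 7F ∷ 8F ∷ 9F ∷ []

module _ {P : Colour → Set} (P? : Decidable P) where

  every? : Dec (∀ c → P c)
  every? = map′ (λ ps c → All.lookup ps (∈-allFin c)) (λ ps → All.tabulate (λ _ → ps _)) (All.all? P? palette)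

  some? : Dec (∃ P)
  some? = map′ Any.satisfied (λ (c , p) → lose (∈-allFin c) p) (Any.any? P? palette)

everySign? : {P : Sign → Set} → Decidable P → Dec (∀ s → P s)
everySign? P? =
  map′ (λ { (p , q) → λ { pos → p ; neg → q } }) (λ p → p pos , p neg) (P? pos ×-dec P? neg)

abstract
  ·-comm : ∀ s t → s · t ≡ t · s
  ·-comm = decide (everySign? λ s → everySign? λ t → (s · t) ≟ˢ (t · s)) refl

ok-sym : ∀ s i j → ok s i j ≡ ok s j i
ok-sym pos i j rewrite ∣-∣-comm (toℕ i) (toℕ j) = refl
ok-sym neg i j = cong not (ok-sym pos i j)

Ok-sym : ∀ s {i j} → Ok s i j → Ok s j i
Ok-sym s {i} {j} (mkOk h) = mkOk (trans (ok-sym s j i) h)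

abstract
  -- Adding 5 turns circular distance d into 5 - d, and d ≤ 2 exactly when 5 - d ≥ 3.
  near-opp : ∀ i j → near (opp i) j ≡ not (near i j)
  near-opp = decide (every? λ i → every? λ j → near (opp i) j ≟ᵇ not (near i j)) refl

ok-act : ∀ s t i j → ok t (act s i) j ≡ ok (s · t) i j
ok-act pos t i j = refl
ok-act neg pos i j = near-opp i j
ok-act neg neg i j = trans (cong not (near-opp i j)) (not-involutive _)

Ok-act : ∀ s t {i j} → Ok (s · t) i j → Ok t (act s i) j
Ok-act s t {i} {j} (mkOk h) = mkOk (trans (ok-act s t i j) h)

Ok-act⁻¹ : ∀ s t {i j} → Ok t (act s i) j → Ok (s · t) i j
Ok-act⁻¹ s t {i} {j} (mkOk h) = mkOk (trans (sym (ok-act s t i j)) h)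

Ok-≡ : ∀ {s t i j} → s ≡ t → Ok s i j → Ok t i j
Ok-≡ refl h = h

Ok-act₂ : ∀ s t u {i j} → Ok (s · t · u) i j → Ok u (act s i) (act t j)
Ok-act₂ s t u h = Ok-act s u (Ok-sym (s · u) (Ok-act t (s · u) (Ok-sym (t · s · u) (Ok-≡ (swap s t u) h))))
  where
  swap : ∀ s t u → s · t · u ≡ t · s · u
  swap = decide (everySign? λ s → everySign? λ t → everySign? λ u → (s · t · u) ≟ˢ (t · s · u)) refl

-- The colours that a neighbour coloured `i` allows across an edge of sign `s` thus form the arc of
-- radius 2 about `act s i`; lists are represented by such centres throughout.
Near-act⇒Ok : ∀ s {i j} → Near (act s i) j → Ok s j i
Near-act⇒Ok s h = Ok-sym s (Ok-≡ (·-comm s pos) (Ok-act⁻¹ s pos h))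

Near-act : ∀ s {i j} → Near (act s i) j → Near i (act s j)
Near-act s h = Ok-sym pos (Ok-act s pos (Ok-≡ (·-comm pos s) (Near-act⇒Ok s h)))

abstract
  -- Rotations are symmetries of the clique, so a finite check may place one list centre at `0F`.
  rotate-onto : ∀ k i → ∃[ j ] rotate k j ≡ i
  rotate-onto = decide (every? λ k → every? λ i → some? λ j → rotate k j ≟ i) refl

  rotate-0 : ∀ k → rotate k 0F ≡ k
  rotate-0 = decide (every? λ k → rotate k 0F ≟ k) refl

  near-rotate : ∀ k i j → near (rotate k i) (rotate k j) ≡ near i j
  near-rotate = decide (every? λ k → every? λ i → every? λ j → near (rotate k i) (rotate k j) ≟ᵇ near i j) refl

Ok-rotate : ∀ s k {i j} → Ok s i j → Ok s (rotate k i) (rotate k j)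
Ok-rotate pos k {i} {j} (mkOk h) = mkOk (trans (near-rotate k i j) h)
Ok-rotate neg k {i} {j} (mkOk h) = mkOk (trans (cong not (near-rotate k i j)) h)

-- Colouring small configurations from lists

abstract
  -- The ends p and r of the chord have all three neighbours inside the diamond, so only q and s
  -- carry lists.
  diamond-colours₀ : ∀ pq qr rs sp pr δ →
    ∃[ p ] ∃[ r ] Ok pr p r ×
    (∃[ q ] Near 0F q × Ok pq p q × Ok qr q r) × (∃[ s ] Near δ s × Ok rs r s × Ok sp s p)
  diamond-colours₀ = decide
    (everySign? λ pq → everySign? λ qr → everySign? λ rs → everySign? λ sp → everySign? λ pr →
     every? λ δ →
     some? λ p → some? λ r → Ok? pr p r ×-dec
     (some? λ q → Ok? pos 0F q ×-dec Ok? pq p q ×-dec Ok? qr q r) ×-dec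
     (some? λ s → Ok? pos δ s ×-dec Ok? rs r s ×-dec Ok? sp s p)) refl

diamond-colours : ∀ pq qr rs sp pr β δ →
  ∃[ p ] ∃[ r ] Ok pr p r ×
  (∃[ q ] Near β q × Ok pq p q × Ok qr q r) × (∃[ s ] Near δ s × Ok rs r s × Ok sp s p)
diamond-colours pq qr rs sp pr β δ with rotate-onto β δ
... | δ₀ , refl
  with diamond-colours₀ pq qr rs sp pr δ₀
... | p , r , opr , (q , βq , opq , oqr) , (s , δs , ors , osp) =
  rotate β p , rotate β r , Ok-rotate pr β opr ,
  (rotate β q , subst (λ i → Near i (rotate β q)) (rotate-0 β) (Ok-rotate pos β βq) , Ok-rotate pq β opq , Ok-rotate qr β oqr) ,
  (rotate β s , Ok-rotate pos β δs , Ok-rotate rs β ors , Ok-rotate sp β osp)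

abstract
  -- A K₄ in a subcubic graph meets no further edge, so there are no lists. The first alternative is
  -- the antibalanced signature; every other one is coloured outright.
  K₄-colours : ∀ pq qr rs sp pr qs →
    (pq · qr · pr ≡ neg × pq · qs · sp ≡ neg × pr · rs · sp ≡ neg × qr · rs · qs ≡ neg) ⊎
    (∃[ p ] ∃[ q ] Ok pq p q × ∃[ r ] Ok pr p r × Ok qr q r ×
     ∃[ s ] Ok rs r s × Ok sp s p × Ok qs q s)
  K₄-colours = decide
    (everySign? λ pq → everySign? λ qr → everySign? λ rs → everySign? λ sp → everySign? λ pr → everySign? λ qs →
     ((pq · qr · pr) ≟ˢ neg ×-dec (pq · qs · sp) ≟ˢ neg ×-dec (pr · rs · sp) ≟ˢ neg ×-dec (qr · rs · qs) ≟ˢ neg)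
     ⊎-dec
     (some? λ p → some? λ q → Ok? pq p q ×-dec some? λ r → Ok? pr p r ×-dec Ok? qr q r ×-dec
      some? λ s → Ok? rs r s ×-dec Ok? sp s p ×-dec Ok? qs q s)) refl

  -- Switch so that `ab` is negative: the hypothesis then puts the centres α and β at distance at
  -- least 3, so these two lists differ, whatever γ is. It has the form of an edge constraint so
  -- that an added edge can enforce it.
  triangle-colours : ∀ ab bc ca α β → Ok ab α β → ∀ γ →
    ∃[ a ] Near α a × ∃[ b ] Near β b × Ok ab a b × ∃[ c ] Near γ c × Ok bc b c × Ok ca c a
  triangle-colours = decide
    (everySign? λ ab → everySign? λ bc → everySign? λ ca → every? λ α → every? λ β →
     Ok? ab α β →-dec every? λ γ →
     some? λ a → Ok? pos α a ×-dec some? λ b → Ok? pos β b ×-dec Ok? ab a b ×-dec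
     some? λ c → Ok? pos γ c ×-dec Ok? bc b c ×-dec Ok? ca c a) refl

  -- The positive 4-cycle has no such lemma: four lists that wind once around the circle defeat it.
  negC₄-colours₀ : ∀ β γ δ → ∃[ p ] Near 0F p × ∃[ r ] Near γ r ×
    (∃[ q ] Near β q × Near p q × Near q r) × (∃[ s ] Near δ s × Near r s × Ok neg s p)
  negC₄-colours₀ = decide
    (every? λ β → every? λ γ → every? λ δ →
     some? λ p → Ok? pos 0F p ×-dec some? λ r → Ok? pos γ r ×-dec
     (some? λ q → Ok? pos β q ×-dec Ok? pos p q ×-dec Ok? pos q r) ×-dec
     (some? λ s → Ok? pos δ s ×-dec Ok? pos r s ×-dec Ok? neg s p)) refl

negC₄-colours⁺ : ∀ α β γ δ → ∃[ p ] Near α p × ∃[ r ] Near γ r ×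
  (∃[ q ] Near β q × Near p q × Near q r) × (∃[ s ] Near δ s × Near r s × Ok neg s p)
negC₄-colours⁺ α β γ δ with rotate-onto α β | rotate-onto α γ | rotate-onto α δ
... | β₀ , refl | γ₀ , refl | δ₀ , refl with negC₄-colours₀ β₀ γ₀ δ₀
... | p , αp , r , γr , (q , βq , opq , oqr) , (s , δs , ors , osp) =
  rotate α p , subst (λ i → Near i (rotate α p)) (rotate-0 α) (Ok-rotate pos α αp) ,
  rotate α r , Ok-rotate pos α γr ,
  (rotate α q , Ok-rotate pos α βq , Ok-rotate pos α opq , Ok-rotate pos α oqr) ,
  (rotate α s , Ok-rotate pos α δs , Ok-rotate pos α ors , Ok-rotate neg α osp)

-- Switching q, r and s by the sign of the path from p along the cycle makes the first three edges
-- positive and leaves the sign of the whole cycle on the last.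
negC₄-colours : ∀ pq qr rs sp → pq · qr · rs · sp ≡ neg → ∀ α β γ δ →
  ∃[ p ] ∃[ q ] ∃[ r ] ∃[ s ] (Near α p × Near β q × Near γ r × Near δ s) ×
  (Ok pq p q × Ok qr q r × Ok rs r s × Ok sp s p)
negC₄-colours pq qr rs sp e α β γ δ
  with negC₄-colours⁺ α (act pq β) (act (pq · qr) γ) (act (pq · qr · rs) δ)
... | p , αp , r , γr , (q , βq , opq , oqr) , (s , δs , ors , osp) =
  p , act pq q , act (pq · qr) r , act (pq · qr · rs) s ,
  (αp , Near-act pq βq , Near-act (pq · qr) γr , Near-act (pq · qr · rs) δs) ,
  Ok-act₂ pos pq pq (Ok-≡ (sym (i₁ pq)) opq) ,
  Ok-act₂ pq (pq · qr) qr (Ok-≡ (sym (i₂ pq qr)) oqr) ,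
  Ok-act₂ (pq · qr) (pq · qr · rs) rs (Ok-≡ (sym (i₃ pq qr rs)) ors) ,
  Ok-act₂ (pq · qr · rs) pos sp (Ok-≡ (sym (trans (i₄ pq qr rs sp) e)) osp)
  where
  i₁ : ∀ a → a · a ≡ pos
  i₁ = decide (everySign? λ a → (a · a) ≟ˢ pos) refl
  i₂ : ∀ a b → a · (a · b) · b ≡ pos
  i₂ = decide (everySign? λ a → everySign? λ b → (a · (a · b) · b) ≟ˢ pos) refl
  i₃ : ∀ a b c → (a · b) · (a · b · c) · c ≡ pos
  i₃ = decide (everySign? λ a → everySign? λ b → everySign? λ c → ((a · b) · (a · b · c) · c) ≟ˢ pos) refl
  i₄ : ∀ a b c d → (a · b · c) · d ≡ a · b · c · d
  i₄ = decide (everySign? λ a → everySign? λ b → everySign? λ c → everySign? λ d →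
    ((a · b · c) · d) ≟ˢ (a · b · c · d)) refl

abstract
  -- The hypothesis says that the centres `act s i` and `act t j` are at distance at most 2, so
  -- their arcs of radius 2 share three consecutive colours.
  arm-colours : ∀ s t i j → Ok (s · t) i j → ∃[ m ] ∀ c → T (within 1 m c) → Ok s c i × Ok t c j
  arm-colours = decide
    (everySign? λ s → everySign? λ t → every? λ i → every? λ j → Ok? (s · t) i j →-dec
     some? λ m → every? λ c → T? (within 1 m c) →-dec (Ok? s c i ×-dec Ok? t c j)) refl

  within-1⇒near : ∀ i j → T (within 1 i j) → Near i j
  within-1⇒near = decide (every? λ i → every? λ j → T? (within 1 i j) →-dec Ok? pos i j) refl

  -- Radii add: an arc of radius 1 seen across an edge becomes one of radius 1 + 2.
  within-3-split : ∀ s m c → T (within 3 (act s m) c) → ∃[ d ] T (within 1 m d) × Ok s c d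
  within-3-split = decide
    (everySign? λ s → every? λ m → every? λ c → T? (within 3 (act s m) c) →-dec
     some? λ d → T? (within 1 m d) ×-dec Ok? s c d) refl

  -- Each arc of radius 3 misses only 3 of the 10 colours.
  three-arcs-meet : ∀ i j k → ∃[ c ] T (within 3 i c) × T (within 3 j c) × T (within 3 k c)
  three-arcs-meet = decide
    (every? λ i → every? λ j → every? λ k →
     some? λ c → T? (within 3 i c) ×-dec T? (within 3 j c) ×-dec T? (within 3 k c)) refl

star-colours : ∀ r s t i j k → ∃[ v ] (∃[ a ] T (within 1 i a) × Ok r v a) ×
  (∃[ b ] T (within 1 j b) × Ok s v b) × (∃[ c ] T (within 1 k c) × Ok t v c)
star-colours r s t i j k with three-arcs-meet (act r i) (act s j) (act t k)
... | v , x , y , z = v , within-3-split r i v x , within-3-split s j v y , within-3-split t k v z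

abstract
  edge-colours : ∀ s β → ∃[ α ] Ok s α β
  edge-colours = decide (everySign? λ s → every? λ β → some? λ α → Ok? s α β) refl
  

-- Signed graphs

infixr 7 _⊗_
-- `nothing` stands for a non-edge and absorbs, so a product equal to `just s` certifies at once
-- that all its edges exist and what their sign is.
_⊗_ : Maybe Sign → Maybe Sign → Maybe Sign
_⊗_ = zipWith _·_

⊗-just⁺ : ∀ {m k s t} → m ≡ just s → k ≡ just t → m ⊗ k ≡ just (s · t)
⊗-just⁺ refl refl = refl

⊗-just⁻ : ∀ m k {s} → m ⊗ k ≡ just s → ∃[ t ] ∃[ u ] m ≡ just t × k ≡ just u × t · u ≡ s
⊗-just⁻ (just t) (just u) refl = t , u , refl , refl , refl

⊗-comm : ∀ m k → m ⊗ k ≡ k ⊗ m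
⊗-comm (just s) (just t) = cong just (·-comm s t)
⊗-comm (just _) nothing = refl
⊗-comm nothing (just _) = refl
⊗-comm nothing nothing = refl

<∣>-just : ∀ m k {s : Sign} → (m <∣> k) ≡ just s → m ≡ just s ⊎ (m ≡ nothing × k ≡ just s)
<∣>-just (just _) k h = inj₁ h
<∣>-just nothing k h = inj₂ (refl , h)

≢neg⇒pos : ∀ {s} → ¬ (s ≡ neg) → s ≡ pos
≢neg⇒pos {pos} _ = refl
≢neg⇒pos {neg} h = ⊥-elim (h refl)

-- Vertices are never removed: a deleted vertex merely becomes isolated, so every reduction stays on
-- `Fin n`.
record Graph (n : ℕ) : Set where
  field
    e     : Fin n → Fin n → Maybe Sign
    e-sym : ∀ x y → e x y ≡ e y x
    e-irr : ∀ x → e x x ≡ nothing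

pattern 1st = here refl
pattern 2nd = there (here refl)
pattern 3rd = there (there (here refl))
pattern 4th = there (there (there (here refl)))

module Structure {n : ℕ} (G : Graph n) where
  open Graph G public

  Adj : Fin n → Fin n → Set
  Adj x y = ∃[ s ] e x y ≡ just s

  Adj? : ∀ x y → Dec (Adj x y)
  Adj? x y with e x y
  ... | just s = yes (s , refl)
  ... | nothing = no λ ()

  ¬Adj⇒nothing : ∀ {x y} → ¬ Adj x y → e x y ≡ nothing
  ¬Adj⇒nothing {x} {y} h with e x y
  ... | just s = ⊥-elim (h (s , refl))
  ... | nothing = refl

  flip-edge : ∀ {x y m} → e x y ≡ m → e y x ≡ m
  flip-edge {x} {y} = trans (e-sym y x)

  Adj-sym : ∀ {x y} → Adj x y → Adj y x
  Adj-sym (s , h) = s , flip-edge h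

  Adj⇒≢ : ∀ {x y} → Adj x y → x ≢ y
  Adj⇒≢ {x} (s , h) refl with trans (sym h) (e-irr x)
  ... | ()

  Nbrs⊆ : Fin n → List (Fin n) → Set
  Nbrs⊆ x xs = ∀ {u} → Adj x u → u ∈ xs

  -- The three names may coincide or fail to be neighbours, so this bounds the degree by 3 without
  -- counting.
  Subcubic : Set
  Subcubic = ∀ x → ∃[ a ] ∃[ b ] ∃[ c ] Nbrs⊆ x (a ∷ b ∷ c ∷ [])

  NegTriangle : Fin n → Fin n → Fin n → Set
  NegTriangle x y z = e x y ⊗ e y z ⊗ e z x ≡ just neg

  -- Signs of triangles are invariant under switching, and all four being negative characterises
  -- (K₄,-) up to switching.
  NegK₄ : Fin n → Fin n → Fin n → Fin n → Set
  NegK₄ p q r s = NegTriangle p q r × NegTriangle p q s × NegTriangle p r s × NegTriangle q r s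

  NoNegK₄ : Set
  NoNegK₄ = ∀ {p q r s} → ¬ NegK₄ p q r s

  -- The 4-cycle pqrs with chord pr; qs may be an edge as well. Adjacency already separates every
  -- pair but q and s.
  Diamond : Fin n → Fin n → Fin n → Fin n → Set
  Diamond p q r s = q ≢ s × Adj p q × Adj q r × Adj r s × Adj s p × Adj p r

  NegC₄ : Fin n → Fin n → Fin n → Fin n → Set
  NegC₄ p q r s = p ≢ r × q ≢ s × e p q ⊗ e q r ⊗ e r s ⊗ e s p ≡ just neg

  K₂₃ : Fin n → Fin n → Fin n → Fin n → Fin n → Set
  K₂₃ a b p q r = a ≢ b × (p ≢ q × p ≢ r × q ≢ r) × (Adj a p × Adj a q × Adj a r) × (Adj b p × Adj b q × Adj b r)

  Triangle : Fin n → Fin n → Fin n → Set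
  Triangle a b c = Adj a b × Adj b c × Adj c a

  Colouring : Set
  Colouring = ∃ λ (f : Fin n → Colour) → ∀ {x y s} → e x y ≡ just s → Ok s (f x) (f y)

  module _ (subcubic : Subcubic) where

    nbrs-given-one : ∀ {x q} → Adj x q → ∃[ y ] ∃[ z ] Nbrs⊆ x (q ∷ y ∷ z ∷ [])
    nbrs-given-one {x} xq with subcubic x
    ... | a , b , c , cover with cover xq
    ...   | 1st = b , c , cover
    ...   | 2nd = a , c , λ xu → case (cover xu)
      where
      case : ∀ {u} → u ∈ a ∷ b ∷ c ∷ [] → u ∈ b ∷ a ∷ c ∷ []
      case 1st = 2nd
      case 2nd = 1st
      case 3rd = 3rd
    ...   | 3rd = a , b , λ xu → case (cover xu)
      where
      case : ∀ {u} → u ∈ a ∷ b ∷ c ∷ [] → u ∈ c ∷ a ∷ b ∷ []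
      case 1st = 2nd
      case 2nd = 3rd
      case 3rd = 1st

    nbrs-given-two : ∀ {x q s} → Adj x q → Adj x s → q ≢ s → ∃[ z ] Nbrs⊆ x (q ∷ s ∷ z ∷ [])
    nbrs-given-two {x} {q} {s} xq xs q≢s with nbrs-given-one xq
    ... | y , z , cover with cover xs
    ...   | 1st = ⊥-elim (q≢s refl)
    ...   | 2nd = z , cover
    ...   | 3rd = y , λ xu → case (cover xu)
      where
      case : ∀ {u} → u ∈ q ∷ y ∷ s ∷ [] → u ∈ q ∷ s ∷ y ∷ []
      case 1st = 1st
      case 2nd = 3rd
      case 3rd = 2nd

    nbrs-given-three : ∀ {x q r s} → Adj x q → Adj x r → Adj x s → q ≢ r → q ≢ s → r ≢ s →
      Nbrs⊆ x (q ∷ r ∷ s ∷ [])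
    nbrs-given-three xq xr xs q≢r q≢s r≢s with nbrs-given-two xq xr q≢r
    ... | z , cover with cover xs
    ...   | 1st = ⊥-elim (q≢s refl)
    ...   | 2nd = ⊥-elim (r≢s refl)
    ...   | 3rd = cover

    no-four-nbrs : ∀ {x q r s t} → Adj x q → Adj x r → Adj x s → Adj x t →
      q ≢ r → q ≢ s → r ≢ s → q ≢ t → r ≢ t → s ≢ t → ⊥
    no-four-nbrs xq xr xs xt q≢r q≢s r≢s q≢t r≢t s≢t with nbrs-given-three xq xr xs q≢r q≢s r≢s xt
    ... | 1st = q≢t refl
    ... | 2nd = r≢t refl
    ... | 3rd = s≢t refl

  -- Negative triangles, antibalanced K₄ and negative 4-cycles

  negTriangle⁺ : ∀ {x y z s t u} → e x y ≡ just s → e y z ≡ just t → e z x ≡ just u →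
    s · t · u ≡ neg → NegTriangle x y z
  negTriangle⁺ xy yz zx h = trans (⊗-just⁺ xy (⊗-just⁺ yz zx)) (cong just h)

  negTriangle⁻ : ∀ {x y z} → NegTriangle x y z →
    ∃[ s ] ∃[ t ] ∃[ u ] e x y ≡ just s × e y z ≡ just t × e z x ≡ just u × s · t · u ≡ neg
  negTriangle⁻ {x} {y} {z} h with ⊗-just⁻ (e x y) (e y z ⊗ e z x) h
  ... | s , v , xy , h′ , sv with ⊗-just⁻ (e y z) (e z x) h′
  ... | t , u , yz , zx , refl = s , t , u , xy , yz , zx , sv

  negTriangle-rotate : ∀ {x y z} → NegTriangle x y z → NegTriangle y z x
  negTriangle-rotate T with negTriangle⁻ T
  ... | s , t , u , xy , yz , zx , h = negTriangle⁺ yz zx xy (trans (rot s t u) h)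
    where
    rot : ∀ s t u → t · u · s ≡ s · t · u
    rot = decide (everySign? λ s → everySign? λ t → everySign? λ u → (t · u · s) ≟ˢ (s · t · u)) refl

  negTriangle-flip : ∀ {x y z} → NegTriangle x y z → NegTriangle y x z
  negTriangle-flip T with negTriangle⁻ T
  ... | s , t , u , xy , yz , zx , h =
    negTriangle⁺ (flip-edge xy) (flip-edge zx) (flip-edge yz) (trans (cong (s ·_) (·-comm u t)) h)

  negTriangle-flip₂₃ : ∀ {x y z} → NegTriangle x y z → NegTriangle x z y
  negTriangle-flip₂₃ T = negTriangle-flip (negTriangle-rotate (negTriangle-rotate T))

  -- This and the next two transpositions generate all relabellings, so any chosen edge can be moved
  -- to pq.
  negK₄-swap₁₂ : ∀ {p q r s} → NegK₄ p q r s → NegK₄ q p r s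
  negK₄-swap₁₂ (pqr , pqs , prs , qrs) = negTriangle-flip pqr , negTriangle-flip pqs , qrs , prs

  negK₄-swap₂₃ : ∀ {p q r s} → NegK₄ p q r s → NegK₄ p r q s
  negK₄-swap₂₃ (pqr , pqs , prs , qrs) =
    negTriangle-flip₂₃ pqr , prs , pqs , negTriangle-flip qrs

  negK₄-swap₃₄ : ∀ {p q r s} → NegK₄ p q r s → NegK₄ p q s r
  negK₄-swap₃₄ (pqr , pqs , prs , qrs) =
    pqs , pqr , negTriangle-flip₂₃ prs ,
    negTriangle-flip₂₃ qrs

  negK₄-adj : ∀ {p q r s} → NegK₄ p q r s → Adj p q × Adj p r × Adj p s × Adj q r × Adj q s × Adj r s
  negK₄-adj (pqr , _ , prs , qrs) =
    let _ , _ , _ , pq , qr , rp , _ = negTriangle⁻ pqr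
        _ , _ , _ , _ , rs , sp , _ = negTriangle⁻ prs
        _ , _ , _ , _ , _ , sq , _ = negTriangle⁻ qrs
    in (_ , pq) , (_ , flip-edge rp) , (_ , flip-edge sp) , (_ , qr) , (_ , flip-edge sq) , (_ , rs)

  negC₄⁺ : ∀ {p q r s pq qr rs sp} → p ≢ r → q ≢ s →
    e p q ≡ just pq → e q r ≡ just qr → e r s ≡ just rs → e s p ≡ just sp →
    pq · qr · rs · sp ≡ neg → NegC₄ p q r s
  negC₄⁺ p≢r q≢s epq eqr ers esp h =
    p≢r , q≢s , trans (⊗-just⁺ epq (⊗-just⁺ eqr (⊗-just⁺ ers esp))) (cong just h)

  C₄-positive : (∀ {p q r s} → ¬ NegC₄ p q r s) → ∀ {p q r s pq qr rs sp} → p ≢ r → q ≢ s →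
    e p q ≡ just pq → e q r ≡ just qr → e r s ≡ just rs → e s p ≡ just sp →
    pq · qr · rs · sp ≡ pos
  C₄-positive noNegC₄ p≢r q≢s pq qr rs sp = ≢neg⇒pos λ h → noNegC₄ (negC₄⁺ p≢r q≢s pq qr rs sp h)

  negC₄⁻ : ∀ {p q r s} → NegC₄ p q r s → ∃[ pq ] ∃[ qr ] ∃[ rs ] ∃[ sp ]
    e p q ≡ just pq × e q r ≡ just qr × e r s ≡ just rs × e s p ≡ just sp × pq · qr · rs · sp ≡ neg
  negC₄⁻ {p} {q} {r} {s} (_ , _ , h) with ⊗-just⁻ (e p q) _ h
  ... | pq , _ , epq , h₁ , i with ⊗-just⁻ (e q r) _ h₁
  ... | qr , _ , eqr , h₂ , refl with ⊗-just⁻ (e r s) _ h₂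
  ... | rs , sp , ers , esp , refl = pq , qr , rs , sp , epq , eqr , ers , esp , i

  _∈?_ : (x : Fin n) (xs : List (Fin n)) → Dec (x ∈ xs)
  _∈?_ = DecMembership._∈?_ _≟_

  -- Extending a colouring over deleted vertices

  Outside : (Fin n → Colour) → List (Fin n) → Fin n → Colour → Set
  Outside f D x c = ∀ {u s} → u ∉ D → e x u ≡ just s → Ok s c (f u)

  ColoursOff : List (Fin n) → (Fin n → Colour) → Set
  ColoursOff D f = ∀ {x y s} → x ∉ D → y ∉ D → e x y ≡ just s → Ok s (f x) (f y)

  Compatible : Fin n × Colour → Fin n × Colour → Set
  Compatible (x , c) (y , d) = ∀ {s} → e x y ≡ just s → Ok s c d

  -- If a vertex is listed twice the first entry counts. Such repetition does occur, namely around a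
  -- vertex with fewer than three neighbours.
  assign : List (Fin n × Colour) → (Fin n → Colour) → Fin n → Colour
  assign [] f y = f y
  assign ((x , c) ∷ as) f y = if does (y ≟ x) then c else assign as f y

  locate : ∀ as f y → (y , assign as f y) ∈ as ⊎ (y ∉ map proj₁ as × assign as f y ≡ f y)
  locate [] f y = inj₂ ((λ ()) , refl)
  locate ((x , c) ∷ as) f y with y ≟ x
  ... | yes refl = inj₁ (here refl)
  ... | no y≢x with locate as f y
  ...   | inj₁ y∈ = inj₁ (there y∈)
  ...   | inj₂ (y∉ , eq) = inj₂ ((λ { (here p) → y≢x p ; (there p) → y∉ p }) , eq)

  compatible-sym : ∀ {a b} → Compatible a b → Compatible b a
  compatible-sym h {s} yx = Ok-sym s (h (flip-edge yx))

  compatible-lookup : ∀ {as a b} → AllPairs Compatible as → a ∈ as → b ∈ as → Compatible a b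
  compatible-lookup (_ ∷ _) 1st 1st xx = ⊥-elim (Adj⇒≢ (_ , xx) refl)
  compatible-lookup (h ∷ _) 1st (there b∈) = lookup h b∈
  compatible-lookup (h ∷ _) (there a∈) 1st = compatible-sym (lookup h a∈)
  compatible-lookup (_ ∷ hs) (there a∈) (there b∈) = compatible-lookup hs a∈ b∈

  -- One hypothesis for each kind of edge: avoiding the listed vertices, leaving them, or joining
  -- two of them.
  extend : ∀ f as → ColoursOff (map proj₁ as) f →
    All (λ (x , c) → Outside f (map proj₁ as) x c) as → AllPairs Compatible as → Colouring
  extend f as off out pairs = assign as f , valid
    where
    valid : ∀ {x y s} → e x y ≡ just s → Ok s (assign as f x) (assign as f y)
    valid {x} {y} {s} xy with locate as f x | locate as f y
    ... | inj₁ x∈ | inj₁ y∈ = compatible-lookup pairs x∈ y∈ xy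
    ... | inj₁ x∈ | inj₂ (y∉ , fy) rewrite fy = lookup out x∈ y∉ xy
    ... | inj₂ (x∉ , fx) | inj₁ y∈ rewrite fx = Ok-sym s (lookup out y∈ x∉ (flip-edge xy))
    ... | inj₂ (x∉ , fx) | inj₂ (y∉ , fy) rewrite fx | fy = off x∉ y∉ xy

  data Outer (D : List (Fin n)) (x : Fin n) : Set where
    none : Nbrs⊆ x D → Outer D x
    one  : ∀ z s → e x z ≡ just s → z ∉ D → (∀ {u} → Adj x u → u ∉ D → u ≡ z) → Outer D x

  outer : ∀ {D x q r z} → Nbrs⊆ x (q ∷ r ∷ z ∷ []) → q ∈ D → r ∈ D → Outer D x
  outer {D} {x} {q} {r} {z} cover q∈ r∈ with z ∈? D | Adj? x z
  ... | yes z∈ | _ = none λ xu → case (cover xu)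
    where
    case : ∀ {u} → u ∈ q ∷ r ∷ z ∷ [] → u ∈ D
    case 1st = q∈
    case 2nd = r∈
    case 3rd = z∈
  ... | no _ | no ¬xz = none λ xu → case xu (cover xu)
    where
    case : ∀ {u} → Adj x u → u ∈ q ∷ r ∷ z ∷ [] → u ∈ D
    case _ 1st = q∈
    case _ 2nd = r∈
    case xz 3rd = ⊥-elim (¬xz xz)
  ... | no z∉ | yes (s , xz) = one z s xz z∉ λ xu → case (cover xu)
    where
    case : ∀ {u} → u ∈ q ∷ r ∷ z ∷ [] → u ∉ D → u ≡ z
    case 1st u∉ = ⊥-elim (u∉ q∈)
    case 2nd u∉ = ⊥-elim (u∉ r∈)
    case 3rd _ = refl

  outside-none : ∀ {f D x c} → Nbrs⊆ x D → Outside f D x c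
  outside-none cover u∉ xu = ⊥-elim (u∉ (cover (_ , xu)))

  outside-one : ∀ {f D x z s c} → e x z ≡ just s → (∀ {u} → Adj x u → u ∉ D → u ≡ z) →
    Near (act s (f z)) c → Outside f D x c
  outside-one {s = s} xz only h u∉ xu with only (_ , xu) u∉
  ... | refl with just-injective (trans (sym xz) xu)
  ... | refl = Near-act⇒Ok s h

  centre-one : ∀ {D x} f z → (∀ {u} → Adj x u → u ∉ D → u ≡ z) → ∃[ α ] ∀ {c} → Near α c → Outside f D x c
  centre-one {x = x} f z only with Adj? x z
  ... | yes (s , xz) = act s (f z) , outside-one xz only
  -- There is no outside neighbour, so every colour is allowed and `f x` is an arbitrary centre.
  ... | no ¬xz = f x , λ _ u∉ xu → ⊥-elim (¬xz (subst (Adj x) (only (_ , xu) u∉) (_ , xu)))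

  centre : ∀ {D x} f → Outer D x → ∃[ α ] ∀ {c} → Near α c → Outside f D x c
  centre {x = x} f (none cover) = f x , λ _ → outside-none {f} cover
  centre f (one z s xz _ only) = act s (f z) , outside-one xz only

-- Reductions

module Rewiring {n : ℕ} (G : Graph n) (D : List (Fin n)) (N : Fin n → Fin n → Maybe Sign)
  (N-sym : ∀ x y → N x y ≡ N y x) (N-irr : ∀ x → N x x ≡ nothing) where

  open Structure G

  -- `<∣>` lets an edge of `G` keep its own sign; `N` contributes only between surviving vertices
  -- that are not adjacent in `G`.
  rewire : Graph n
  rewire = record { e = e′ ; e-sym = e′-sym ; e-irr = e′-irr }
    where
    e′ : Fin n → Fin n → Maybe Sign
    e′ x y = if does (x ∈? D) ∨ does (y ∈? D) then nothing else (e x y <∣> N x y)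
    e′-sym : ∀ x y → e′ x y ≡ e′ y x
    e′-sym x y rewrite ∨-comm (does (x ∈? D)) (does (y ∈? D)) | e-sym x y | N-sym x y = refl
    e′-irr : ∀ x → e′ x x ≡ nothing
    e′-irr x with x ∈? D
    ... | yes _ = refl
    ... | no _ rewrite e-irr x | N-irr x = refl

  module R = Structure rewire

  Fresh : Fin n → Fin n → Set
  Fresh x y = e x y ≡ nothing × ∃[ s ] N x y ≡ just s

  fresh-sym : ∀ {x y} → Fresh x y → Fresh y x
  fresh-sym {x} {y} (xy , s , h) = flip-edge xy , s , trans (N-sym y x) h

  rewire-e : ∀ {x y} → x ∉ D → y ∉ D → R.e x y ≡ (e x y <∣> N x y)
  rewire-e {x} {y} x∉ y∉ with x ∈? D | y ∈? D
  ... | yes x∈ | _ = ⊥-elim (x∉ x∈)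
  ... | no _ | yes y∈ = ⊥-elim (y∉ y∈)
  ... | no _ | no _ = refl

  rewire-old : ∀ {x y s} → x ∉ D → y ∉ D → e x y ≡ just s → R.e x y ≡ just s
  rewire-old {x} {y} x∉ y∉ h = trans (rewire-e x∉ y∉) (cong (_<∣> N x y) h)

  rewire-fresh : ∀ {x y s} → x ∉ D → y ∉ D → e x y ≡ nothing → N x y ≡ just s → R.e x y ≡ just s
  rewire-fresh {x} {y} x∉ y∉ h h′ = trans (rewire-e x∉ y∉) (trans (cong (_<∣> N x y) h) h′)

  rewire-ends : ∀ {x y} → R.Adj x y → x ∉ D × y ∉ D
  rewire-ends {x} {y} (s , h) with x ∈? D | y ∈? D
  ... | no x∉ | no y∉ = x∉ , y∉

  rewire-edge : ∀ {x y s} → R.e x y ≡ just s → e x y ≡ just s ⊎ (e x y ≡ nothing × N x y ≡ just s)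
  rewire-edge {x} {y} h with rewire-ends (_ , h)
  ... | x∉ , y∉ = <∣>-just (e x y) (N x y) (trans (sym (rewire-e x∉ y∉)) h)

  rewire-status : ∀ {x y s} → R.e x y ≡ just s → e x y ≡ just s ⊎ Fresh x y
  rewire-status h with rewire-edge h
  ... | inj₁ old = inj₁ old
  ... | inj₂ (xy , new) = inj₂ (xy , _ , new)

  rewire-coloursOff : ∀ {f} → (∀ {x y s} → R.e x y ≡ just s → Ok s (f x) (f y)) → ColoursOff D f
  rewire-coloursOff valid x∉ y∉ xy = valid (rewire-old x∉ y∉ xy)

  -- A new edge at x replaces an edge of x to the deleted vertex it is routed through.
  rewire-subcubic : Subcubic → (Via : Fin n → Fin n → Fin n → Set) →
    (∀ {x u} → R.Adj x u → Fresh x u → ∃[ d ] d ∈ D × Adj x d × Via x d u) →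
    (∀ x d → ∃[ m ] ∀ {u} → Via x d u → u ≡ m) → R.Subcubic
  rewire-subcubic subcubic Via route mate x with subcubic x
  ... | a , b , c , cover = move a , move b , move c , λ xu → find xu
    where
    move : Fin n → Fin n
    move d = if does (d ∈? D) then proj₁ (mate x d) else d
    move-in : ∀ {d u} → d ∈ D → Via x d u → u ≡ move d
    move-in {d} d∈ via with d ∈? D
    ... | yes _ = proj₂ (mate x d) via
    ... | no d∉ = ⊥-elim (d∉ d∈)
    move-out : ∀ {d} → d ∉ D → d ≡ move d
    move-out {d} d∉ with d ∈? D
    ... | yes d∈ = ⊥-elim (d∉ d∈)
    ... | no _ = refl
    place : ∀ {d u} → u ≡ move d → d ∈ a ∷ b ∷ c ∷ [] → u ∈ move a ∷ move b ∷ move c ∷ []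
    place refl 1st = 1st
    place refl 2nd = 2nd
    place refl 3rd = 3rd
    find : ∀ {u} → R.Adj x u → u ∈ move a ∷ move b ∷ move c ∷ []
    find xu with rewire-status (proj₂ xu)
    ... | inj₁ old = place (move-out (proj₂ (rewire-ends xu))) (cover (_ , old))
    ... | inj₂ fresh with route xu fresh
    ...   | d , d∈ , xd , via = place (move-in d∈ via) (cover xd)

  -- No isolated vertex may revive, since the induction counts non-isolated vertices.
  rewire-alive : (∀ {x u} → R.Adj x u → Fresh x u → ∃ (Adj x)) → ∀ {x u} → R.Adj x u → ∃ (Adj x)
  rewire-alive route xu with rewire-status (proj₂ xu)
  ... | inj₁ old = _ , _ , old
  ... | inj₂ fresh = route xu fresh

  -- With all six edges old, the K₄ would already lie in `G`; otherwise a relabelling makes pq new.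
  rewire-noNegK₄ : NoNegK₄ → (∀ {p q r s} → R.NegK₄ p q r s → ¬ Fresh p q) → R.NoNegK₄
  rewire-noNegK₄ noK noFresh K =
    noK (old K , old (R.negK₄-swap₃₄ K) ,
         old (R.negK₄-swap₃₄ (R.negK₄-swap₂₃ K)) , old (R.negK₄-swap₃₄ (R.negK₄-swap₂₃ (R.negK₄-swap₁₂ K))))
    where
    old : ∀ {p q r s} → R.NegK₄ p q r s → NegTriangle p q r
    old K@(pqr , _) with R.negTriangle⁻ pqr
    ... | _ , _ , _ , pq , qr , rp , h with rewire-status pq | rewire-status qr | rewire-status rp
    ... | inj₁ pq′ | inj₁ qr′ | inj₁ rp′ = negTriangle⁺ pq′ qr′ rp′ h
    ... | inj₂ fresh | _ | _ = ⊥-elim (noFresh K fresh)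
    ... | _ | inj₂ fresh | _ = ⊥-elim (noFresh (R.negK₄-swap₂₃ (R.negK₄-swap₁₂ K)) fresh)
    ... | _ | _ | inj₂ fresh = ⊥-elim (noFresh (R.negK₄-swap₁₂ (R.negK₄-swap₂₃ K)) fresh)

module _ {n : ℕ} where

  link : Fin n → Fin n → Sign → Fin n → Fin n → Maybe Sign
  link a b σ x y = if (does (x ≟ a) ∧ does (y ≟ b)) ∨ (does (x ≟ b) ∧ does (y ≟ a)) then just σ else nothing

  link-sym : ∀ a b σ x y → link a b σ x y ≡ link a b σ y x
  link-sym a b σ x y
    rewrite ∧-comm (does (y ≟ a)) (does (x ≟ b)) | ∧-comm (does (y ≟ b)) (does (x ≟ a))
          | ∨-comm (does (x ≟ a) ∧ does (y ≟ b)) (does (x ≟ b) ∧ does (y ≟ a)) = refl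

  link-irr : ∀ {a b} σ → a ≢ b → ∀ x → link a b σ x x ≡ nothing
  link-irr {a} {b} σ a≢b x with x ≟ a | x ≟ b
  ... | yes refl | yes refl = ⊥-elim (a≢b refl)
  ... | yes _ | no _ = refl
  ... | no _ | yes _ = refl
  ... | no _ | no _ = refl

  link-hit : ∀ a b σ → link a b σ a b ≡ just σ
  link-hit a b σ with a ≟ a | b ≟ b
  ... | yes _ | yes _ = refl
  ... | no a≢a | _ = ⊥-elim (a≢a refl)
  ... | yes _ | no b≢b = ⊥-elim (b≢b refl)

  link-just : ∀ a b σ x y {s} → link a b σ x y ≡ just s → (x ≡ a × y ≡ b) ⊎ (x ≡ b × y ≡ a)
  link-just a b σ x y h with x ≟ a | y ≟ b | x ≟ b | y ≟ a
  ... | yes p | yes q | _ | _ = inj₁ (p , q)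
  ... | yes _ | no _ | yes r | yes s = inj₂ (r , s)
  ... | no _ | _ | yes r | yes s = inj₂ (r , s)
  link-just a b σ x y () | yes _ | no _ | no _ | _
  link-just a b σ x y () | yes _ | no _ | yes _ | no _
  link-just a b σ x y () | no _ | _ | no _ | _
  link-just a b σ x y () | no _ | _ | yes _ | no _

-- The reducible configurations

module Reduction {n : ℕ} (G : Graph n) where

  open Structure G

  -- The induction hypothesis. Some deleted vertex must have an edge, so that the number of
  -- non-isolated vertices falls; the remaining conditions keep it from growing and keep the graph
  -- in the class.
  Reduces : Set
  Reduces = ∀ D N N-sym N-irr → let open Rewiring G D N N-sym N-irr in
    (∃[ x ] ∃[ y ] x ∈ D × Adj x y) → (∀ {x u} → R.Adj x u → ∃ (Adj x)) → R.Subcubic → R.NoNegK₄ → R.Colouring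

  module _ (reduces : Reduces) (subcubic : Subcubic) (noNegK₄ : NoNegK₄) where

    delete : ∀ D {x y} → x ∈ D → Adj x y → ∃[ f ] ColoursOff D f
    delete D x∈ xy =
      let f , valid = reduces D (λ _ _ → nothing) (λ _ _ → refl) (λ _ → refl) (_ , _ , x∈ , xy)
            (rewire-alive (λ { _ (_ , _ , ()) }))
            (rewire-subcubic subcubic (λ _ _ _ → ⊥) (λ { _ (_ , _ , ()) }) (λ x _ → x , λ ()))
            (rewire-noNegK₄ noNegK₄ (λ { _ (_ , _ , ()) }))
      in f , rewire-coloursOff {f} valid
      where open Rewiring G D (λ _ _ → nothing) (λ _ _ → refl) (λ _ → refl)

    compatible : ∀ {x y c d s} → e x y ≡ just s → Ok s c d → Compatible (x , c) (y , d)
    compatible xy h xy′ = Ok-≡ (just-injective (trans (sym xy) xy′)) h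

    non-adjacent : ∀ {x y c d} → e x y ≡ nothing → Compatible (x , c) (y , d)
    non-adjacent xy xy′ with trans (sym xy) xy′
    ... | ()

    nbrs⊆-three : ∀ {D x a b c} → Adj x a → Adj x b → Adj x c → a ≢ b → a ≢ c → b ≢ c →
      a ∈ D → b ∈ D → c ∈ D → Nbrs⊆ x D
    nbrs⊆-three xa xb xc ab ac bc a∈ b∈ c∈ xu with nbrs-given-three subcubic xa xb xc ab ac bc xu
    ... | 1st = a∈
    ... | 2nd = b∈
    ... | 3rd = c∈

    reduce-K₄ : ∀ {p q r s} → Diamond p q r s → Adj q s → Colouring
    reduce-K₄ {p} {q} {r} {s} (q≢s , P@(_ , pq) , Q@(_ , qr) , R@(_ , rs) , S@(_ , sp) , T@(_ , pr)) U@(_ , qs) =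
      case (K₄-colours _ _ _ _ _ _)
      where
      case : _ → Colouring
      case (inj₁ (pqr , pqs , prs , qrs)) = ⊥-elim (noNegK₄
        ( negTriangle⁺ pq qr (flip-edge pr) pqr , negTriangle⁺ pq qs sp pqs
        , negTriangle⁺ pr rs sp prs , negTriangle⁺ qr rs (flip-edge qs) qrs))
      case (inj₂ (cp , cq , pq✓ , cr , pr✓ , qr✓ , cs , rs✓ , sp✓ , qs✓)) =
        let f , off = delete (p ∷ q ∷ r ∷ s ∷ []) 1st P
        in extend f ((p , cp) ∷ (q , cq) ∷ (r , cr) ∷ (s , cs) ∷ []) off
          ( outside-none {f} (nbrs⊆-three P T (Adj-sym S) (Adj⇒≢ Q) q≢s (Adj⇒≢ R) 2nd 3rd 4th)
          ∷ outside-none {f} (nbrs⊆-three (Adj-sym P) Q U (Adj⇒≢ T) (≢-sym (Adj⇒≢ S)) (Adj⇒≢ R) 1st 3rd 4th)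
          ∷ outside-none {f} (nbrs⊆-three (Adj-sym T) (Adj-sym Q) R (Adj⇒≢ P) (≢-sym (Adj⇒≢ S)) q≢s 1st 2nd 4th)
          ∷ outside-none {f} (nbrs⊆-three S (Adj-sym U) (Adj-sym R) (Adj⇒≢ P) (Adj⇒≢ T) (Adj⇒≢ Q) 1st 2nd 3rd)
          ∷ [])
          ( (compatible pq pq✓ ∷ compatible pr pr✓ ∷ compatible-sym (compatible sp sp✓) ∷ [])
          ∷ (compatible qr qr✓ ∷ compatible qs qs✓ ∷ [])
          ∷ (compatible rs rs✓ ∷ [])
          ∷ [] ∷ [])

    reduce-chord : ∀ {p q r s} → Diamond p q r s → ¬ Adj q s → Colouring
    reduce-chord {p} {q} {r} {s} (q≢s , P@(_ , pq) , Q@(_ , qr) , R@(_ , rs) , S@(_ , sp) , T@(_ , pr)) ¬qs =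
      let f , off = delete D 1st P
          _ , coverQ = nbrs-given-two subcubic (Adj-sym P) Q (Adj⇒≢ T)
          _ , coverS = nbrs-given-two subcubic S (Adj-sym R) (Adj⇒≢ T)
          β , outQ = centre {D} f (outer coverQ 1st 3rd)
          δ , outS = centre {D} f (outer coverS 1st 3rd)
          cp , cr , pr✓ , (cq , βq , pq✓ , qr✓) , (cs , δs , rs✓ , sp✓) = diamond-colours _ _ _ _ _ β δ
      in extend f ((p , cp) ∷ (q , cq) ∷ (r , cr) ∷ (s , cs) ∷ []) off
        ( outside-none {f} (nbrs⊆-three P T (Adj-sym S) (Adj⇒≢ Q) q≢s (Adj⇒≢ R) 2nd 3rd 4th)
        ∷ outQ βq
        ∷ outside-none {f} (nbrs⊆-three (Adj-sym T) (Adj-sym Q) R (Adj⇒≢ P) (≢-sym (Adj⇒≢ S)) q≢s 1st 2nd 4th)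
        ∷ outS δs
        ∷ [])
        ( (compatible pq pq✓ ∷ compatible pr pr✓ ∷ compatible-sym (compatible sp sp✓) ∷ [])
        ∷ (compatible qr qr✓ ∷ non-adjacent (¬Adj⇒nothing ¬qs) ∷ [])
        ∷ (compatible rs rs✓ ∷ [])
        ∷ [] ∷ [])
      where
      D : List (Fin n)
      D = p ∷ q ∷ r ∷ s ∷ []

    reduce-diamond : ∀ {p q r s} → Diamond p q r s → Colouring
    reduce-diamond {q = q} {s = s} dia with Adj? q s
    ... | yes qs = reduce-K₄ dia qs
    ... | no ¬qs = reduce-chord dia ¬qs

    module _ (noDiamond : ∀ {p q r s} → ¬ Diamond p q r s) where

      -- Without diamonds the cycle is induced, so its four edges and one list per vertex are the
      -- only constraints.
      reduce-negC₄ : ∀ {p q r s} → NegC₄ p q r s → Colouring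
      reduce-negC₄ {p} {q} {r} {s} C@(p≢r , q≢s , _) =
        let _ , _ , _ , _ , pq , qr , rs , sp , sign = negC₄⁻ C
            P = _ , pq ; Q = _ , qr ; R = _ , rs ; S = _ , sp
            f , off = delete D 1st P
            _ , coverP = nbrs-given-two subcubic P (Adj-sym S) q≢s
            _ , coverQ = nbrs-given-two subcubic (Adj-sym P) Q p≢r
            _ , coverR = nbrs-given-two subcubic (Adj-sym Q) R q≢s
            _ , coverS = nbrs-given-two subcubic S (Adj-sym R) p≢r
            α , outP = centre {D} f (outer coverP 2nd 4th)
            β , outQ = centre {D} f (outer coverQ 1st 3rd)
            γ , outR = centre {D} f (outer coverR 2nd 4th)
            δ , outS = centre {D} f (outer coverS 1st 3rd)
            cp , cq , cr , cs , (αp , βq , γr , δs) , (pq✓ , qr✓ , rs✓ , sp✓) =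
              negC₄-colours _ _ _ _ sign α β γ δ
        in extend f ((p , cp) ∷ (q , cq) ∷ (r , cr) ∷ (s , cs) ∷ []) off
          (outP αp ∷ outQ βq ∷ outR γr ∷ outS δs ∷ [])
          ( ( compatible pq pq✓
            ∷ non-adjacent (¬Adj⇒nothing λ pr → noDiamond (q≢s , P , Q , R , S , pr))
            ∷ compatible-sym (compatible sp sp✓) ∷ [])
          ∷ ( compatible qr qr✓
            ∷ non-adjacent (¬Adj⇒nothing λ qs → noDiamond (≢-sym p≢r , Q , R , S , P , qs)) ∷ [])
          ∷ (compatible rs rs✓ ∷ [])
          ∷ [] ∷ [])
        where
        D : List (Fin n)
        D = p ∷ q ∷ r ∷ s ∷ []

      module _ (noNegC₄ : ∀ {p q r s} → ¬ NegC₄ p q r s) where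

        -- Once all its 4-cycles are positive, K₂₃ makes a and b twins up to switching.
        reduce-K₂₃ : ∀ {a b p q r} → K₂₃ a b p q r → Colouring
        reduce-K₂₃ {a} {b} {p} {q} {r}
          (a≢b , (p≢q , p≢r , q≢r) , ((ap , aep) , (_ , aeq) , (_ , aer)) , (Bp@(bp , bep) , Bq , Br)) =
          let f , off = delete (b ∷ []) 1st Bp
          -- `b` copies the colour of its twin, switched when the path a p b is negative.
          in extend f ((b , act (ap · bp) (f a)) ∷ []) off
               ((λ u∉ bu → twin f off u∉ bu (nbrs-given-three subcubic Bp Bq Br p≢q p≢r q≢r (_ , bu))) ∷ []) ([] ∷ [])
          where
          cancel : ∀ s t → (s · t) · t ≡ s
          cancel = decide (everySign? λ s → everySign? λ t → ((s · t) · t) ≟ˢ s) refl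
          solve : ∀ s t u v → s · t · u · v ≡ pos → (s · t) · u ≡ v
          solve = decide (everySign? λ s → everySign? λ t → everySign? λ u → everySign? λ v →
            ((s · t · u · v) ≟ˢ pos) →-dec (((s · t) · u) ≟ˢ v)) refl
          -- The 4-cycle a p b u is positive, so the paths a p b and a u b have equal sign.
          same : ∀ {u s v} → p ≢ u → e a u ≡ just v → e b u ≡ just s → (ap · bp) · s ≡ v
          same p≢u au bu = solve ap bp _ _ (C₄-positive noNegC₄ a≢b p≢u aep (flip-edge bep) bu (flip-edge au))
          twin : ∀ f → ColoursOff (b ∷ []) f → ∀ {u s} → u ∉ b ∷ [] → e b u ≡ just s → u ∈ p ∷ q ∷ r ∷ [] →
            Ok s (act (ap · bp) (f a)) (f u)
          twin f off {u} {s} u∉ bu = λ where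
              1st → copy aep (trans (cong ((ap · bp) ·_) (just-injective (trans (sym bu) bep))) (cancel ap bp))
              2nd → copy aeq (same p≢q aeq bu)
              3rd → copy aer (same p≢r aer bu)
            where
            copy : ∀ {t} → e a u ≡ just t → (ap · bp) · s ≡ t → Ok s (act (ap · bp) (f a)) (f u)
            copy au eq = Ok-act (ap · bp) s (Ok-≡ (sym eq) (off (λ { (here a≡b) → a≢b a≡b }) u∉ au))

        reduce-triangle : ∀ {a b c} → Triangle a b c → Colouring
        reduce-triangle {a} {b} {c} (AB@(ab , aeb) , BC@(bc , bec) , CA@(ca , cea)) =
          let _ , coverA = nbrs-given-two subcubic AB (Adj-sym CA) (Adj⇒≢ BC)
              _ , coverB = nbrs-given-two subcubic (Adj-sym AB) BC (≢-sym (Adj⇒≢ CA))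
              _ , coverC = nbrs-given-two subcubic CA (Adj-sym BC) (Adj⇒≢ AB)
          in cases (outer coverC 1st 2nd) (outer coverA 2nd 3rd) (outer coverB 1st 3rd)
          where
          D : List (Fin n)
          D = a ∷ b ∷ c ∷ []

          finish : ∀ f → ColoursOff D f → Outer D c → ∀ {α β} → Ok ab α β →
            (∀ {c} → Near α c → Outside f D a c) → (∀ {c} → Near β c → Outside f D b c) → Colouring
          finish f off oc {α} {β} αβ outA outB =
            let γ , outC = centre f oc
                cA , αa , cB , βb , ab✓ , cC , γc , bc✓ , ca✓ = triangle-colours ab bc ca α β αβ γ
            in extend f ((a , cA) ∷ (b , cB) ∷ (c , cC) ∷ []) off
              (outA αa ∷ outB βb ∷ outC γc ∷ [])
              ( (compatible aeb ab✓ ∷ compatible-sym (compatible cea ca✓) ∷ [])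
              ∷ (compatible bec bc✓ ∷ []) ∷ [] ∷ [])

          cases : Outer D c → Outer D a → Outer D b → Colouring
          cases oc (none coverA) ob =
            let f , off = delete D 1st AB
                β , outB = centre f ob
                -- `a` has no list, so its centre is free and is chosen to suit β.
                α , αβ = edge-colours ab β
            in finish f off oc αβ (λ _ → outside-none {f} coverA) outB
          cases oc oa@(one _ _ _ _ _) (none coverB) =
            let f , off = delete D 1st AB
                α , outA = centre f oa
                β , βα = edge-colours ab α
            in finish f off oc (Ok-sym ab βα) outA (λ _ → outside-none {f} coverB)
          cases oc (one a′ x ax a′∉ onlyA) (one b′ y by b′∉ onlyB) =
            let f , valid = reduces D N N-sym N-irr (a , b , 1st , AB)
                  (rewire-alive λ uv fresh → let d , _ , ud , _ = route uv fresh in d , ud)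
                  (rewire-subcubic subcubic Via route mate) (rewire-noNegK₄ noNegK₄ noFresh)
            in finish f (rewire-coloursOff {f} valid) oc (Ok-act₂ x y ab (joined f valid))
                 (outside-one {f} ax onlyA) (outside-one {f} by onlyB)
            where
            -- A common outer neighbour would close the 4-cycle a c b a′ with chord ab.
            a′≢b′ : a′ ≢ b′
            a′≢b′ refl = noDiamond ((λ { refl → a′∉ 3rd }) , Adj-sym CA , Adj-sym BC , (_ , by) , (_ , flip-edge ax) , AB)

            -- The new edge has the sign of the path a′ a b b′, so after `Ok-act₂` it says that the
            -- list centres of a and b satisfy `Ok ab`.
            N : Fin n → Fin n → Maybe Sign
            N = link a′ b′ (x · y · ab)
            N-sym : ∀ u v → N u v ≡ N v u
            N-sym = link-sym a′ b′ (x · y · ab)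
            N-irr : ∀ u → N u u ≡ nothing
            N-irr = link-irr (x · y · ab) a′≢b′

            open Rewiring G D N N-sym N-irr

            Via : Fin n → Fin n → Fin n → Set
            Via _ d u = (d ≡ a × u ≡ b′) ⊎ (d ≡ b × u ≡ a′)

            route : ∀ {u v} → R.Adj u v → Fresh u v → ∃[ d ] d ∈ D × Adj u d × Via u d v
            route {u} {v} _ (_ , _ , h) with link-just a′ b′ _ u v h
            ... | inj₁ (refl , refl) = a , 1st , (_ , flip-edge ax) , inj₁ (refl , refl)
            ... | inj₂ (refl , refl) = b , 2nd , (_ , flip-edge by) , inj₂ (refl , refl)

            mate : ∀ u d → ∃[ m ] ∀ {v} → Via u d v → v ≡ m
            mate u d with d ≟ a
            ... | yes refl = b′ , λ { (inj₁ (_ , eq)) → eq ; (inj₂ (a≡b , _)) → ⊥-elim (Adj⇒≢ AB a≡b) }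
            ... | no d≢a = a′ , λ { (inj₁ (d≡a , _)) → ⊥-elim (d≢a d≡a) ; (inj₂ (_ , eq)) → eq }

            -- Only one edge is new, so removing it from the K₄ leaves a diamond of `G` with chord
            -- rs.
            noFresh : ∀ {p q r s} → R.NegK₄ p q r s → ¬ Fresh p q
            noFresh K pq =
              let PQ , PR , PS , QR , QS , RS = R.negK₄-adj K
                  no-r = λ {v} → fresh-only {v = v} pq (≢-sym (R.Adj⇒≢ PR)) (≢-sym (R.Adj⇒≢ QR))
                  no-s = λ {v} → fresh-only {v = v} pq (≢-sym (R.Adj⇒≢ PS)) (≢-sym (R.Adj⇒≢ QS))
              in noDiamond
                ( ≢-sym (R.Adj⇒≢ PQ) , old (R.Adj-sym QR) no-r , old QS (no-s ∘ fresh-sym)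
                , old (R.Adj-sym PS) no-s , old PR (no-r ∘ fresh-sym) , old RS no-r)
              where
              old : ∀ {u v} → R.Adj u v → ¬ Fresh u v → Adj u v
              old (_ , uv) ¬fresh with rewire-status uv
              ... | inj₁ uv′ = _ , uv′
              ... | inj₂ fresh = ⊥-elim (¬fresh fresh)
              fresh-only : ∀ {p q u v} → Fresh p q → u ≢ p → u ≢ q → ¬ Fresh u v
              fresh-only {p} {q} {u} {v} (_ , _ , pq) u≢p u≢q (_ , _ , uv) with link-just a′ b′ _ p q pq | link-just a′ b′ _ u v uv
              ... | inj₁ (refl , refl) | inj₁ (refl , _) = u≢p refl
              ... | inj₁ (refl , refl) | inj₂ (refl , _) = u≢q refl
              ... | inj₂ (refl , refl) | inj₁ (refl , _) = u≢q refl
              ... | inj₂ (refl , refl) | inj₂ (refl , _) = u≢p refl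

            joined : ∀ f → (∀ {u v s} → R.e u v ≡ just s → Ok s (f u) (f v)) → Ok (x · y · ab) (f a′) (f b′)
            joined f valid with Adj? a′ b′
            -- An existing edge a′b′ keeps its own sign; the positive 4-cycle a′ a b b′ forces it to
            -- be the required one.
            ... | yes (t , h) = Ok-≡ (solve x ab y t positive) (valid (rewire-old a′∉ b′∉ h))
              where
              solve : ∀ s t u v → s · t · u · v ≡ pos → v ≡ s · u · t
              solve = decide (everySign? λ s → everySign? λ t → everySign? λ u → everySign? λ v →
                ((s · t · u · v) ≟ˢ pos) →-dec (v ≟ˢ (s · u · t))) refl
              positive : x · ab · y · t ≡ pos
              positive = C₄-positive noNegC₄ (λ { refl → a′∉ 2nd }) (λ { refl → b′∉ 1st })
                (flip-edge ax) aeb by (flip-edge h)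
            ... | no ¬a′b′ = valid (rewire-fresh a′∉ b′∉ (¬Adj⇒nothing ¬a′b′) (link-hit a′ b′ _))

        module _ (noK₂₃ : ∀ {a b p q r} → ¬ K₂₃ a b p q r) (noTriangle : ∀ {a b c} → ¬ Triangle a b c) where

          -- Deleting a vertex together with its neighbours

          module Star {v a b c} (va : Adj v a) (vb : Adj v b) (vc : Adj v c) (cover : Nbrs⊆ v (a ∷ b ∷ c ∷ [])) where

            D : List (Fin n)
            D = v ∷ a ∷ b ∷ c ∷ []

            through : Fin n → Fin n → Fin n → Maybe Sign
            through d x y = e d x ⊗ e d y

            -- If several of a, b, c connect x to y the first one wins; `N-sign` shows that the
            -- choice is immaterial for surviving x and y.
            N : Fin n → Fin n → Maybe Sign
            N x y = if does (x ≟ y) then nothing else (through a x y <∣> through b x y <∣> through c x y)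

            N-sym : ∀ x y → N x y ≡ N y x
            N-sym x y with x ≟ y | y ≟ x
            ... | yes _ | yes _ = refl
            ... | yes x≡y | no y≢x = ⊥-elim (y≢x (sym x≡y))
            ... | no x≢y | yes y≡x = ⊥-elim (x≢y (sym y≡x))
            ... | no _ | no _
              rewrite ⊗-comm (e a x) (e a y) | ⊗-comm (e b x) (e b y) | ⊗-comm (e c x) (e c y) = refl

            N-irr : ∀ x → N x x ≡ nothing
            N-irr x with x ≟ x
            ... | yes _ = refl
            ... | no x≢x = ⊥-elim (x≢x refl)

            open Rewiring G D N N-sym N-irr

            N-just : ∀ x y {s} → N x y ≡ just s →
              x ≢ y × ∃[ d ] ∃[ t ] ∃[ u ] Adj v d × e d x ≡ just t × e d y ≡ just u × t · u ≡ s
            N-just x y h with x ≟ y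
            ... | no x≢y = x≢y , arm h
              where
              arm : ∀ {s} → (through a x y <∣> through b x y <∣> through c x y) ≡ just s →
                ∃[ d ] ∃[ t ] ∃[ u ] Adj v d × e d x ≡ just t × e d y ≡ just u × t · u ≡ s
              arm h with <∣>-just (through a x y) _ h
              ... | inj₁ h₁ = let t , u , dx , dy , eq = ⊗-just⁻ (e a x) (e a y) h₁ in a , t , u , va , dx , dy , eq
              ... | inj₂ (_ , h₁) with <∣>-just (through b x y) _ h₁
              ...   | inj₁ h₂ = let t , u , dx , dy , eq = ⊗-just⁻ (e b x) (e b y) h₂ in b , t , u , vb , dx , dy , eq
              ...   | inj₂ (_ , h₂) = let t , u , dx , dy , eq = ⊗-just⁻ (e c x) (e c y) h₂ in c , t , u , vc , dx , dy , eq

            N-some : ∀ {d x y t u} → Adj v d → x ≢ y → e d x ≡ just t → e d y ≡ just u → ∃[ s ] N x y ≡ just s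
            N-some {d} {x} {y} vd x≢y dx dy with x ≟ y
            ... | yes x≡y = ⊥-elim (x≢y x≡y)
            ... | no _ = arm (cover vd)
              where
              arm : d ∈ a ∷ b ∷ c ∷ [] → ∃[ s ] (through a x y <∣> through b x y <∣> through c x y) ≡ just s
              arm 1st rewrite dx | dy = _ , refl
              arm 2nd rewrite dx | dy with through a x y
              ... | just _ = _ , refl
              ... | nothing = _ , refl
              arm 3rd rewrite dx | dy with through a x y | through b x y
              ... | just _ | _ = _ , refl
              ... | nothing | just _ = _ , refl
              ... | nothing | nothing = _ , refl

            v≢ : ∀ {x} → x ∉ D → v ≢ x
            v≢ x∉ refl = x∉ 1st

            -- Two different hubs for the same pair x, y would form a K₂₃ with v, x and y.
            N-sign : ∀ {d x y t u} → x ∉ D → y ∉ D → Adj v d → x ≢ y → e d x ≡ just t → e d y ≡ just u →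
              N x y ≡ just (t · u)
            N-sign {d} {x} {y} x∉ y∉ vd x≢y dx dy
              with N-some vd x≢y dx dy
            ... | s , h with N-just x y h
            ... | _ , d′ , t′ , u′ , vd′ , dx′ , dy′ , eq with d ≟ d′
            ... | no d≢d′ = ⊥-elim (noK₂₃
                    ( d≢d′ , (v≢ x∉ , v≢ y∉ , x≢y)
                    , (Adj-sym vd , (_ , dx) , (_ , dy)) , (Adj-sym vd′ , (_ , dx′) , (_ , dy′))))
            ... | yes refl = trans h (cong just (trans (sym eq)
                    (cong₂ _·_ (just-injective (trans (sym dx′) dx)) (just-injective (trans (sym dy′) dy)))))

            Via : Fin n → Fin n → Fin n → Set
            Via x d u = Adj v d × Adj d x × Adj d u × x ≢ u × v ≢ x × v ≢ u

            route : ∀ {x u} → R.Adj x u → Fresh x u → ∃[ d ] d ∈ D × Adj x d × Via x d u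
            route {x} {u} xu (_ , _ , h) =
              let x≢u , d , _ , _ , vd , dx , du , _ = N-just x u h
                  x∉ , u∉ = rewire-ends xu
              in d , there (cover vd) , (_ , flip-edge dx) , vd , (_ , dx) , (_ , du) , x≢u , v≢ x∉ , v≢ u∉

            mate : ∀ x d → ∃[ m ] ∀ {u} → Via x d u → u ≡ m
            mate x d with Adj? v d | Adj? d x | v ≟ x
            -- In this and the next two cases no new edge at x runs through d, and `v` is a mere
            -- default.
            ... | no ¬vd | _ | _ = v , λ (vd , _) → ⊥-elim (¬vd vd)
            ... | yes _ | no ¬dx | _ = v , λ (_ , dx , _) → ⊥-elim (¬dx dx)
            ... | yes _ | yes _ | yes v≡x = v , λ (_ , _ , _ , _ , v≢x , _) → ⊥-elim (v≢x v≡x)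
            ... | yes vd | yes dx | no v≢x =
              let z , coverD = nbrs-given-two subcubic (Adj-sym vd) dx v≢x
              in z , λ (_ , _ , du , x≢u , _ , v≢u) → case x≢u v≢u (coverD du)
              where
              case : ∀ {u z} → x ≢ u → v ≢ u → u ∈ v ∷ x ∷ z ∷ [] → u ≡ z
              case x≢u v≢u 1st = ⊥-elim (v≢u refl)
              case x≢u v≢u 2nd = ⊥-elim (x≢u refl)
              case x≢u v≢u 3rd = refl

            hub : ∀ {x y} → Fresh x y → ∃[ d ] Adj v d × Adj d x × Adj d y
            hub {x} {y} (_ , _ , h) = let _ , d , _ , _ , vd , dx , dy , _ = N-just x y h in d , vd , (_ , dx) , (_ , dy)

            -- A hub has degree at most 3 and is adjacent to v, so it serves a single pair of
            -- surviving vertices.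
            hub-≢ : ∀ {d d′ x y z} → x ∉ D → y ∉ D → z ∉ D → x ≢ y → x ≢ z → y ≢ z →
              Adj v d → Adj d x → Adj d y → Adj d′ z → d ≢ d′
            hub-≢ x∉ y∉ z∉ x≢y x≢z y≢z vd dx dy dz refl =
              no-four-nbrs subcubic (Adj-sym vd) dx dy dz (v≢ x∉) (v≢ y∉) x≢y (v≢ z∉) x≢z y≢z

            -- A new edge and two old ones close up, through the hub, to a positive 4-cycle of G.
            negTriangle-fresh : ∀ {x y z} → R.NegTriangle x y z → Fresh x y → Fresh x z ⊎ Fresh y z
            negTriangle-fresh {x} {y} {z} T (xy , _) with R.negTriangle⁻ T
            ... | s₁ , s₂ , s₃ , xy′ , yz , zx , sign with rewire-edge xy′ | rewire-status yz | rewire-status zx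
            ... | inj₁ old | _ | _ with trans (sym old) xy
            ...   | ()
            negTriangle-fresh _ _ | _ | inj₂ _ | inj₂ fresh | _ = inj₂ fresh
            negTriangle-fresh _ _ | _ | inj₂ _ | inj₁ _ | inj₂ fresh = inj₁ (fresh-sym fresh)
            negTriangle-fresh {x} {y} {z} _ _ | s₁ , s₂ , s₃ , _ , _ , zx′ , sign | inj₂ (_ , h) | inj₁ yz | inj₁ zx =
              let x≢y , d , t , u , vd , dx , dy , eq = N-just x y h
                  z∉ = proj₁ (rewire-ends (_ , zx′))
              in ⊥-elim (clash t u s₂ s₃
                   (C₄-positive noNegC₄ (λ { refl → z∉ (there (cover vd)) }) x≢y dx (flip-edge zx) (flip-edge yz) (flip-edge dy))
                   (trans (cong (_· s₂ · s₃) eq) sign))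
              where
              clash : ∀ t u s₂ s₃ → t · s₃ · s₂ · u ≡ pos → (t · u) · s₂ · s₃ ≡ neg → ⊥
              clash = decide (everySign? λ t → everySign? λ u → everySign? λ s₂ → everySign? λ s₃ →
                ((t · s₃ · s₂ · u) ≟ˢ pos) →-dec (((t · u) · s₂ · s₃) ≟ˢ neg) →-dec no λ ()) refl

            -- If xw were new too, three hubs would form a K₂₃ with v and x. So the triangles xyw
            -- and xzw force yw and zw to be new, and xy, xz, yw, zw need four distinct hubs around
            -- v.
            noFresh-corner : ∀ {x y z w} → R.NegK₄ x y z w → Fresh x y → ¬ Fresh x z
            noFresh-corner {x} {y} {z} {w} K@(_ , xyw , xzw , _) xy xz =
              let XY , XZ , XW , YZ , YW , ZW = R.negK₄-adj K
                  x∉ , y∉ = rewire-ends XY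
                  z∉ , w∉ = rewire-ends ZW
                  d₁ , vd₁ , d₁x , d₁y = hub xy
                  d₂ , vd₂ , d₂x , d₂z = hub xz
                  x≢y = R.Adj⇒≢ XY ; x≢z = R.Adj⇒≢ XZ ; x≢w = R.Adj⇒≢ XW
                  y≢z = R.Adj⇒≢ YZ ; y≢w = R.Adj⇒≢ YW ; z≢w = R.Adj⇒≢ ZW
                  d₁≢d₂ = hub-≢ x∉ y∉ z∉ x≢y x≢z y≢z vd₁ d₁x d₁y d₂z
                  spoke : ¬ Fresh x w
                  spoke = λ xw →
                    let d₃ , vd₃ , d₃x , d₃w = hub xw
                        d₁≢d₃ = hub-≢ x∉ y∉ w∉ x≢y x≢w y≢w vd₁ d₁x d₁y d₃w
                        d₂≢d₃ = hub-≢ x∉ z∉ w∉ x≢z x≢w z≢w vd₂ d₂x d₂z d₃w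
                    in noK₂₃ ( v≢ x∉ , (d₁≢d₂ , d₁≢d₃ , d₂≢d₃)
                             , (vd₁ , vd₂ , vd₃) , (Adj-sym d₁x , Adj-sym d₂x , Adj-sym d₃x))
                  rim : Fresh y w → Fresh z w → ⊥
                  rim = λ yw zw →
                    let d₃ , vd₃ , d₃y , d₃w = hub yw
                        d₄ , vd₄ , d₄z , d₄w = hub zw
                        d₁≢d₃ = hub-≢ x∉ y∉ w∉ x≢y x≢w y≢w vd₁ d₁x d₁y d₃w
                        d₁≢d₄ = hub-≢ x∉ y∉ w∉ x≢y x≢w y≢w vd₁ d₁x d₁y d₄w
                        d₂≢d₃ = hub-≢ x∉ z∉ w∉ x≢z x≢w z≢w vd₂ d₂x d₂z d₃w
                        d₂≢d₄ = hub-≢ x∉ z∉ w∉ x≢z x≢w z≢w vd₂ d₂x d₂z d₄w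
                        d₃≢d₄ = hub-≢ y∉ w∉ z∉ y≢w y≢z (≢-sym z≢w) vd₃ d₃y d₃w d₄z
                    in no-four-nbrs subcubic vd₁ vd₂ vd₃ vd₄ d₁≢d₂ d₁≢d₃ d₂≢d₃ d₁≢d₄ d₂≢d₄ d₃≢d₄
              in [ spoke , (λ yw → [ spoke , rim yw ]′ (negTriangle-fresh xzw xz)) ]′ (negTriangle-fresh xyw xy)

            noFresh : ∀ {p q r s} → R.NegK₄ p q r s → ¬ Fresh p q
            noFresh K@(pqr , _) pq with negTriangle-fresh pqr pq
            ... | inj₁ pr = noFresh-corner K pq pr
            ... | inj₂ qr = noFresh-corner (R.negK₄-swap₁₂ K) (fresh-sym pq) qr

            -- With at most one outer neighbour the list contains an arc of radius 2, hence one of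
            -- radius 1 about the same centre. With two, the new edge between them supplies the
            -- hypothesis of `arm-colours`.
            arm : ∀ f → (∀ {x y s} → R.e x y ≡ just s → Ok s (f x) (f y)) → ∀ {d} → Adj v d →
              ∃[ m ] ∀ {k} → T (within 1 m k) → Outside f D d k
            arm f valid {d} vd with nbrs-given-one subcubic (Adj-sym vd)
            ... | y , z , coverD = split (usable? y) (usable? z) (y ≟ z)
              where
              Usable : Fin n → Set
              Usable u = Adj d u × u ∉ D
              usable? : ∀ u → Dec (Usable u)
              usable? u = Adj? d u ×-dec ¬? (u ∈? D)
              single : ∀ w → (∀ {u} → Adj d u → u ∉ D → u ≡ w) → ∃[ m ] ∀ {k} → T (within 1 m k) → Outside f D d k
              single w only = let m , out = centre-one f w only in m , λ h → out (within-1⇒near m _ h)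
              only : ∀ {u} → Adj d u → u ∉ D → u ≡ y ⊎ u ≡ z
              only du u∉ with coverD du
              ... | 1st = ⊥-elim (u∉ 1st)
              ... | 2nd = inj₁ refl
              ... | 3rd = inj₂ refl
              split : Dec (Usable y) → Dec (Usable z) → Dec (y ≡ z) → ∃[ m ] ∀ {k} → T (within 1 m k) → Outside f D d k
              split (no ¬y) _ _ = single z λ du u∉ → [ (λ { refl → ⊥-elim (¬y (du , u∉)) }) , (λ eq → eq) ]′ (only du u∉)
              split _ (no ¬z) _ = single y λ du u∉ → [ (λ eq → eq) , (λ { refl → ⊥-elim (¬z (du , u∉)) }) ]′ (only du u∉)
              split _ _ (yes refl) = single z λ du u∉ → [ (λ eq → eq) , (λ eq → eq) ]′ (only du u∉)
              split (yes ((t , dy) , y∉)) (yes ((u , dz) , z∉)) (no y≢z) =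
                -- For want of triangles yz is no edge of `G`, so it really is added, with the sign
                -- of the path y d z.
                let yz = ¬Adj⇒nothing λ yz → noTriangle ((_ , dy) , yz , (_ , flip-edge dz))
                    m , ok✓ = arm-colours t u (f y) (f z) (valid (rewire-fresh y∉ z∉ yz (N-sign y∉ z∉ vd y≢z dy dz)))
                in m , λ {k} h {w} w∉ dw → pick (ok✓ k h) dw (only (_ , dw) w∉)
                where
                pick : ∀ {k w s} → Ok t k (f y) × Ok u k (f z) → e d w ≡ just s → w ≡ y ⊎ w ≡ z → Ok s k (f w)
                pick (h , _) dw (inj₁ refl) = Ok-≡ (just-injective (trans (sym dy) dw)) h
                pick (_ , h) dw (inj₂ refl) = Ok-≡ (just-injective (trans (sym dz) dw)) h

            apart : ∀ {d d′ k k′} → Adj v d → Adj v d′ → Compatible (d , k) (d′ , k′)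
            apart vd vd′ = non-adjacent (¬Adj⇒nothing λ dd′ → noTriangle (vd , dd′ , Adj-sym vd′))

            star-colouring : Colouring
            star-colouring =
              let f , valid = reduces D N N-sym N-irr (v , a , 1st , va)
                    (rewire-alive λ xu fresh → let d , _ , xd , _ = route xu fresh in d , xd)
                    (rewire-subcubic subcubic Via route mate) (rewire-noNegK₄ noNegK₄ noFresh)
                  i , outA = arm f valid va
                  j , outB = arm f valid vb
                  k , outC = arm f valid vc
                  cv , (cA , iA , va✓) , (cB , jB , vb✓) , (cC , kC , vc✓) = star-colours _ _ _ i j k
              in extend f ((v , cv) ∷ (a , cA) ∷ (b , cB) ∷ (c , cC) ∷ []) (rewire-coloursOff {f} valid)
                (outside-none {f} (λ vu → there (cover vu)) ∷ outA iA ∷ outB jB ∷ outC kC ∷ [])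
                ( (compatible (proj₂ va) va✓ ∷ compatible (proj₂ vb) vb✓ ∷ compatible (proj₂ vc) vc✓ ∷ [])
                ∷ (apart va vb ∷ apart va vc ∷ []) ∷ (apart vb vc ∷ []) ∷ [] ∷ [])

          reduce-star : ∀ {v w} → Adj v w → Colouring
          reduce-star {v} {w} vw with subcubic v
          ... | a , b , c , cover = Star.star-colouring (nbr-adj a) (nbr-adj b) (nbr-adj c) λ vu → place vu (cover vu)
            where
            -- Names that are not neighbours of `v` are replaced by the known neighbour `w`, at the
            -- price of repetitions.
            nbr : Fin n → Fin n
            nbr d = if does (Adj? v d) then d else w
            nbr-adj : ∀ d → Adj v (nbr d)
            nbr-adj d with Adj? v d
            ... | yes vd = vd
            ... | no _ = vw
            nbr-≡ : ∀ {d} → Adj v d → d ≡ nbr d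
            nbr-≡ {d} vd with Adj? v d
            ... | yes _ = refl
            ... | no ¬vd = ⊥-elim (¬vd vd)
            place : ∀ {u} → Adj v u → u ∈ a ∷ b ∷ c ∷ [] → u ∈ nbr a ∷ nbr b ∷ nbr c ∷ []
            place vu 1st = here (nbr-≡ vu)
            place vu 2nd = there (here (nbr-≡ vu))
            place vu 3rd = there (there (here (nbr-≡ vu)))

-- Induction and transfer to the given graph

module Search {n : ℕ} (G : Graph n) where

  open Structure G
  open Reduction G

  diamond? : Dec (∃[ p ] ∃[ q ] ∃[ r ] ∃[ s ] Diamond p q r s)
  diamond? = any? λ p → any? λ q → any? λ r → any? λ s →
    ¬? (q ≟ s) ×-dec Adj? p q ×-dec Adj? q r ×-dec Adj? r s ×-dec Adj? s p ×-dec Adj? p r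

  negC₄? : Dec (∃[ p ] ∃[ q ] ∃[ r ] ∃[ s ] NegC₄ p q r s)
  negC₄? = any? λ p → any? λ q → any? λ r → any? λ s →
    ¬? (p ≟ r) ×-dec ¬? (q ≟ s) ×-dec ≡-dec _≟ˢ_ (e p q ⊗ e q r ⊗ e r s ⊗ e s p) (just neg)

  K₂₃? : Dec (∃[ a ] ∃[ b ] ∃[ p ] ∃[ q ] ∃[ r ] K₂₃ a b p q r)
  K₂₃? = any? λ a → any? λ b → any? λ p → any? λ q → any? λ r →
    ¬? (a ≟ b) ×-dec (¬? (p ≟ q) ×-dec ¬? (p ≟ r) ×-dec ¬? (q ≟ r)) ×-dec
    (Adj? a p ×-dec Adj? a q ×-dec Adj? a r) ×-dec (Adj? b p ×-dec Adj? b q ×-dec Adj? b r)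

  triangle? : Dec (∃[ a ] ∃[ b ] ∃[ c ] Triangle a b c)
  triangle? = any? λ a → any? λ b → any? λ c → Adj? a b ×-dec Adj? b c ×-dec Adj? c a

  edge? : Dec (∃[ a ] ∃[ b ] Adj a b)
  edge? = any? λ a → any? λ b → Adj? a b

  reduce : Reduces → Subcubic → NoNegK₄ → Colouring
  reduce reduces subcubic noNegK₄ with diamond?
  ... | yes (_ , _ , _ , _ , h) = reduce-diamond reduces subcubic noNegK₄ h
  ... | no ¬diamond with negC₄?
  ... | yes (_ , _ , _ , _ , h) = reduce-negC₄ reduces subcubic noNegK₄ (λ h → ¬diamond (_ , _ , _ , _ , h)) h
  ... | no ¬negC₄ with K₂₃?
  ... | yes (_ , _ , _ , _ , _ , h) =
    reduce-K₂₃ reduces subcubic noNegK₄ (λ h → ¬diamond (_ , _ , _ , _ , h)) (λ h → ¬negC₄ (_ , _ , _ , _ , h)) h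
  ... | no ¬K₂₃ with triangle?
  ... | yes (_ , _ , _ , h) =
    reduce-triangle reduces subcubic noNegK₄ (λ h → ¬diamond (_ , _ , _ , _ , h)) (λ h → ¬negC₄ (_ , _ , _ , _ , h)) h
  ... | no ¬triangle with edge?
  ... | yes (_ , _ , h) =
    reduce-star reduces subcubic noNegK₄ (λ h → ¬diamond (_ , _ , _ , _ , h)) (λ h → ¬negC₄ (_ , _ , _ , _ , h))
      (λ h → ¬K₂₃ (_ , _ , _ , _ , _ , h)) (λ h → ¬triangle (_ , _ , _ , h)) h
  ... | no ¬edge = (λ _ → 0F) , λ xy → ⊥-elim (¬edge (_ , _ , _ , xy))

open Structure using (Adj; Subcubic; NoNegK₄; Colouring)

-- `L` is any list containing all non-isolated vertices, and the induction is on a bound for its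
-- length.
colourable : ∀ {n} m (G : Graph n) (L : List (Fin n)) → length L ≤ m → (∀ {x y} → Adj G x y → x ∈ L) →
  Subcubic G → NoNegK₄ G → Colouring G
colourable zero G [] _ support _ _ = (λ _ → 0F) , λ xy → ⊥-elim (impossible (support (_ , xy)))
  where
  impossible : ∀ {A : Set} {x : A} → ¬ (x ∈ [])
  impossible ()
colourable (suc m) G L L≤m support subcubic noNegK₄ = Search.reduce G smaller subcubic noNegK₄
  where
  smaller : Reduction.Reduces G
  smaller D N N-sym N-irr (x , _ , x∈ , xy) alive =
    colourable m rewire (filter (λ u → ¬? (Structure._∈?_ G u D)) L)
      -- The filter drops `x`, which is in `L` because it has an edge; hence the length falls.
      (s≤s⁻¹ (≤-trans (filter-notAll _ L (lose (support xy) (λ x∉ → x∉ x∈))) L≤m))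
      (λ uv → ∈-filter⁺ _ (support (proj₂ (alive uv))) (proj₁ (rewire-ends uv)))
    where open Rewiring G D N N-sym N-irr

-- Recognising (K₄,-) and reading off the circular colouring

module Transfer (G : SignedGraph) where

  V : Set
  V = Fin (n G)

  graph : Graph (n G)
  graph = record { e = edge ; e-sym = edge-sym ; e-irr = edge-irr }
    where
    edge : V → V → Maybe Sign
    edge x y = if adj G x y then just (sign G x y) else nothing
    edge-sym : ∀ x y → edge x y ≡ edge y x
    edge-sym x y rewrite adj-sym G x y | sign-sym G x y = refl
    edge-irr : ∀ x → edge x x ≡ nothing
    edge-irr x rewrite adj-irr G x = refl

  open Structure graph hiding (Adj; Subcubic; NoNegK₄; Colouring)

  edge⁺ : ∀ {x y} → adj G x y ≡ true → e x y ≡ just (sign G x y)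
  edge⁺ h rewrite h = refl

  edge⁻ : ∀ {x y s} → e x y ≡ just s → adj G x y ≡ true × sign G x y ≡ s
  edge⁻ {x} {y} h with adj G x y
  edge⁻ h | true = refl , just-injective h

  nbrs : V → List V
  nbrs v = filter (λ u → adj G v u ≟ᵇ true) (allFin (n G))

  length-nbrs : ∀ v → length (nbrs v) ≡ degree G v
  length-nbrs v = go (allFin (n G))
    where
    go : ∀ us → length (filter (λ u → adj G v u ≟ᵇ true) us) ≡ sum (map (λ u → if adj G v u then 1 else 0) us)
    go [] = refl
    go (u ∷ us) with adj G v u
    ... | true = cong suc (go us)
    ... | false = go us

  pad : V → ∀ us → length us ≤ 3 → ∃[ a ] ∃[ b ] ∃[ c ] ∀ {u} → u ∈ us → u ∈ a ∷ b ∷ c ∷ []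
  pad v [] _ = v , v , v , λ ()
  pad v (a ∷ []) _ = a , v , v , λ { 1st → 1st }
  pad v (a ∷ b ∷ []) _ = a , b , v , λ { 1st → 1st ; 2nd → 2nd }
  pad v (a ∷ b ∷ c ∷ []) _ = a , b , c , λ u∈ → u∈
  pad v (_ ∷ _ ∷ _ ∷ _ ∷ _) (s≤s (s≤s (s≤s ())))

  degree≤3⇒subcubic : (∀ v → degree G v ≤ 3) → Subcubic graph
  degree≤3⇒subcubic deg v =
    let a , b , c , cover = pad v (nbrs v) (subst (_≤ 3) (sym (length-nbrs v)) (deg v))
    in a , b , c , λ (_ , vu) → cover (∈-filter⁺ _ (∈-allFin _) (proj₁ (edge⁻ vu)))

  -- In a subcubic graph a K₄ is closed under adjacency, so connectedness makes it the whole graph: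
  -- `ψ` is a bijection with inverse `φ`.
  module _ (connected : Connected G) (subcubic : Subcubic graph) {p q r s : V} (K : NegK₄ p q r s) where

    ψ : Fin 4 → V
    ψ 0F = p
    ψ 1F = q
    ψ 2F = r
    ψ 3F = s

    ψ-adj : ∀ i j → i ≢ j → Adj graph (ψ i) (ψ j)
    ψ-adj i j i≢j =
      let pq , pr , ps , qr , qs , rs = negK₄-adj K in go pq pr ps qr qs rs i j i≢j
      where
      go : Adj graph p q → Adj graph p r → Adj graph p s → Adj graph q r → Adj graph q s → Adj graph r s →
        ∀ i j → i ≢ j → Adj graph (ψ i) (ψ j)
      go pq pr ps qr qs rs = λ where
        0F 0F i≢j → ⊥-elim (i≢j refl)
        0F 1F _ → pq
        0F 2F _ → pr
        0F 3F _ → ps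
        1F 0F _ → Adj-sym pq
        1F 1F i≢j → ⊥-elim (i≢j refl)
        1F 2F _ → qr
        1F 3F _ → qs
        2F 0F _ → Adj-sym pr
        2F 1F _ → Adj-sym qr
        2F 2F i≢j → ⊥-elim (i≢j refl)
        2F 3F _ → rs
        3F 0F _ → Adj-sym ps
        3F 1F _ → Adj-sym qs
        3F 2F _ → Adj-sym rs
        3F 3F i≢j → ⊥-elim (i≢j refl)

    ψ-≢ : ∀ i j → i ≢ j → ψ i ≢ ψ j
    ψ-≢ i j i≢j = Adj⇒≢ (ψ-adj i j i≢j)

    ψ-injective : ∀ i j → ψ i ≡ ψ j → i ≡ j
    ψ-injective i j eq with i ≟ j
    ... | yes i≡j = i≡j
    ... | no i≢j = ⊥-elim (ψ-≢ i j i≢j eq)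

    ψ-closed : ∀ i {w} → Adj graph (ψ i) w → ∃[ j ] ψ j ≡ w
    ψ-closed = λ where
        0F → closed 0F 1F 2F 3F (λ ()) (λ ()) (λ ()) (λ ()) (λ ()) (λ ())
        1F → closed 1F 0F 2F 3F (λ ()) (λ ()) (λ ()) (λ ()) (λ ()) (λ ())
        2F → closed 2F 0F 1F 3F (λ ()) (λ ()) (λ ()) (λ ()) (λ ()) (λ ())
        3F → closed 3F 0F 1F 2F (λ ()) (λ ()) (λ ()) (λ ()) (λ ()) (λ ())
      where
      closed : ∀ i j k l → i ≢ j → i ≢ k → i ≢ l → j ≢ k → j ≢ l → k ≢ l →
        ∀ {w} → Adj graph (ψ i) w → ∃[ m ] ψ m ≡ w
      closed i j k l ij ik il jk jl kl iw
        with nbrs-given-three subcubic (ψ-adj i j ij) (ψ-adj i k ik) (ψ-adj i l il) (ψ-≢ j k jk) (ψ-≢ j l jl) (ψ-≢ k l kl) iw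
      ... | here eq = j , sym eq
      ... | there (here eq) = k , sym eq
      ... | there (there (here eq)) = l , sym eq

    ψ-reaches : ∀ i {v w} → ψ i ≡ v → Walk G v w → ∃[ j ] ψ j ≡ w
    ψ-reaches i eq here = i , eq
    ψ-reaches i refl (step iw walk) =
      let j , eq = ψ-closed i (_ , edge⁺ iw) in ψ-reaches j eq walk

    φ : V → Fin 4
    φ u = proj₁ (ψ-reaches 0F refl (connected p u))

    ψ-φ : ∀ u → ψ (φ u) ≡ u
    ψ-φ u = proj₂ (ψ-reaches 0F refl (connected p u))

    φ-injective : ∀ {u v} → φ u ≡ φ v → u ≡ v
    φ-injective {u} {v} eq = trans (sym (ψ-φ u)) (trans (cong ψ eq) (ψ-φ v))

    ψ-negTriangle : ∀ i j → 0F ≢ i → 0F ≢ j → i ≢ j → NegTriangle p (ψ i) (ψ j)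
    ψ-negTriangle i j 0≢i 0≢j i≢j = go K i j 0≢i 0≢j i≢j
      where
      go : NegK₄ p q r s → ∀ i j → 0F ≢ i → 0F ≢ j → i ≢ j → NegTriangle p (ψ i) (ψ j)
      go (pqr , pqs , prs , _) = λ where
        0F _ 0≢i _ _ → ⊥-elim (0≢i refl)
        _ 0F _ 0≢j _ → ⊥-elim (0≢j refl)
        1F 1F _ _ i≢j → ⊥-elim (i≢j refl)
        1F 2F _ _ _ → pqr
        1F 3F _ _ _ → pqs
        2F 1F _ _ _ → negTriangle-flip₂₃ pqr
        2F 2F _ _ i≢j → ⊥-elim (i≢j refl)
        2F 3F _ _ _ → prs
        3F 1F _ _ _ → negTriangle-flip₂₃ pqs
        3F 2F _ _ _ → negTriangle-flip₂₃ prs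
        3F 3F _ _ i≢j → ⊥-elim (i≢j refl)

    negTriangle-at-p : ∀ {u v} → p ≢ u → p ≢ v → u ≢ v → NegTriangle p u v
    negTriangle-at-p {u} {v} p≢u p≢v u≢v = subst₂ (NegTriangle p) (ψ-φ u) (ψ-φ v)
      (ψ-negTriangle (φ u) (φ v)
        (λ eq → p≢u (trans (cong ψ eq) (ψ-φ u))) (λ eq → p≢v (trans (cong ψ eq) (ψ-φ v))) (u≢v ∘ φ-injective))

    isPos : Sign → Bool
    isPos pos = true
    isPos neg = false

    -- Switching the positive neighbours of p makes every edge at p negative.
    switched : V → Bool
    switched u = if does (p ≟ u) then false else isPos (sign G p u)

    -- For an edge uv away from p, the triangle puv stays negative under switching and has two
    -- negative edges at p, so uv is negative too.
    switched-neg : ∀ u v → adj G u v ≡ true → sign (switch G switched) u v ≡ neg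
    switched-neg u v uv with p ≟ u | p ≟ v
    ... | yes refl | yes refl = ⊥-elim (Adj⇒≢ (_ , edge⁺ uv) refl)
    ... | yes refl | no _ with sign G p v
    ...   | pos = refl
    ...   | neg = refl
    switched-neg u v uv | no _ | yes refl rewrite sign-sym G u p with sign G p u
    ...   | pos = refl
    ...   | neg = refl
    switched-neg u v uv | no p≢u | no p≢v =
      let a , b , c , pu , uv′ , vp , h = negTriangle⁻ (negTriangle-at-p p≢u p≢v (Adj⇒≢ (_ , edge⁺ uv)))
      in subst₂ (λ x z → (if isPos x xor isPos z then flipSign (sign G u v) else sign G u v) ≡ neg)
           (sym (proj₂ (edge⁻ pu))) (sym (proj₂ (edge⁻ (flip-edge vp))))
           (subst (λ y → (if isPos a xor isPos c then flipSign y else y) ≡ neg) (sym (proj₂ (edge⁻ uv′))) (solve a b c h))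
      where
      solve : ∀ a b c → a · b · c ≡ neg → (if isPos a xor isPos c then flipSign b else b) ≡ neg
      solve = decide (everySign? λ a → everySign? λ b → everySign? λ c →
        ((a · b · c) ≟ˢ neg) →-dec ((if isPos a xor isPos c then flipSign b else b) ≟ˢ neg)) refl

    negK₄⇒switchIso : SwitchIso G K4neg
    negK₄⇒switchIso = switched , record
      { f = record
        { to = φ
        ; cong = cong φ
        ; bijective = φ-injective , λ i → ψ i , λ { refl → ψ-injective _ _ (ψ-φ (ψ i)) }
        }
      ; adj-pres = adj-pres
      ; sign-pres = switched-neg
      }
      where
      adj-pres : ∀ u v → adj G u v ≡ not (does (φ u ≟ φ v))
      adj-pres u v with φ u ≟ φ v
      ... | yes eq = trans (cong (adj G u) (sym (φ-injective eq))) (adj-irr G u)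
      ... | no φu≢φv = proj₁ (edge⁻ (proj₂ (subst₂ (Adj graph) (ψ-φ u) (ψ-φ v) (ψ-adj (φ u) (φ v) φu≢φv))))

  -- For p = 10 and q = 3 the bounds p/2 - q and p/2 + q are 2 and 8, in agreement with `near`.
  Ok⇒posEdge : ∀ i j → Ok pos i j → PosEdgeK 5 3 i j
  Ok⇒posEdge = decide (every? λ i → every? λ j → Ok? pos i j →-dec (_ ≤? _ ⊎-dec _ ≤? _)) refl

  Ok⇒negEdge : ∀ i j → Ok neg i j → NegEdgeK 5 3 i j
  Ok⇒negEdge = decide (every? λ i → every? λ j → Ok? neg i j →-dec (_ ≤? _ ×-dec _ ≤? _)) refl

  colouring⇒circHom : Colouring graph → CircHom G 5 3
  colouring⇒circHom (f , valid) = f , λ u v uv →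
    (λ s → Ok⇒posEdge _ _ (valid (trans (edge⁺ uv) (cong just s)))) ,
    (λ s → Ok⇒negEdge _ _ (valid (trans (edge⁺ uv) (cong just s))))

theorem1p2 : (G : SignedGraph) → Connected G → MaxDegree G 3 →
    ¬ SwitchIso G K4neg → ChiCLe G 10 3
theorem1p2 G connected (deg , _) notK₄ c d _ h =
  -- One colouring, with p = 2 · 5 and q = 3, serves every c/d above 10/3.
  5 , 3 , (s≤s z≤n , s≤s (s≤s (s≤s z≤n)) , colouring⇒circHom colouring) , <⇒≤ h
  where
  open Transfer G
  subcubic : Subcubic graph
  subcubic = degree≤3⇒subcubic deg
  colouring : Colouring graph
  colouring = colourable _ graph (allFin (n G)) ≤-refl (λ _ → ∈-allFin _) subcubic
    (λ K → notK₄ (negK₄⇒switchIso connected subcubic K))
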